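{- Let $k\ge 1$ and let $\Upsilon$ be a subset of $\mathcal{F}_{2,k}$. Then $$1+\sum_{n\ge 1}\frac{t^{2n}}{(2kn)!}\sum_{F\in\mathcal{F}^{(2),\Upsilon}_{2n,k}}x^{\Upsilon\text{ -mch}^{(2)}(F)}=\frac{1}{1-\sum_{n\ge 1}\frac{(x-1)^{n-1}t^{2n}}{(2kn)!}\,full^{\Upsilon}_{2n}}.$$
   Context: $\mathcal{F}_{n,k}$ is the set of all fillings $F$ of the $k\times n$ rectangular array ($k$ rows, $n$ columns) with the integers $1,\dots,kn$, each used once, such that the elements in each column increase from bottom to top. For a filling of a $k\times n$ array by distinct positive integers with columns increasing from bottom to top, $\mathrm{red}(F)\in\mathcal{F}_{n,k}$ is obtained by replacing the $i$-th smallest entry by $i$. $F[i,i+1]$ is the $k\times 2$ filling formed by columns $i$ and $i+1$ of $F$. For $\Upsilon\subseteq\mathcal{F}_{2,k}$, $F\in\mathcal{F}_{n,k}$ has an $\Upsilon$-match starting at position $i$ ($1\le i\le n-1$) if $\mathrm{red}(F[i,i+1])\in\Upsilon$; $S^{\Upsilon}(F)$ is the set of all such $i$. $\mathcal{F}^{(2),\Upsilon}_{2n,k}$ is the set of $F\in\mathcal{F}_{2n,k}$ such that every odd number in $\{1,\dots,2n\}$ belongs to $S^{\Upsilon}(F)$. $\Upsilon\text{ -mch}^{(2)}(F)$ is the number of $i$ such that $2i\in S^{\Upsilon}(F)$. $full^{\Upsilon}_n$ is the number of $F\in\mathcal{F}_{n,k}$ with $\Upsilon$-matches starting at every position $1,\dots,n-1$.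 The identity is one of formal power series in $t$ with coefficients in $\mathbb{Q}[x]$. -}

module Defs where

open import Algebra.Bundles using (CommutativeRing; RawRing)
import Algebra.Construct.Pointwise as Pointwise
open import Algebra.Structures using (IsCommutativeRing)
open import Algebra.Morphism.Structures using (IsRingMonomorphism)
import Algebra.Morphism.RingMonomorphism as RingMonomorphism
import Algebra.Properties.Semiring.Exp as SemiringExp
import Algebra.Properties.Semiring.Sum as SemiringSum
open import Data.Fin.Base using (Fin; zero; suc; toℕ; inject₁)
import Data.Fin.Properties as Fin
open import Data.Integer.Base using (+_)
open import Data.List.Base as List using (List; []; _∷_; applyUpTo; cartesianProductWith; filter; foldr; length)
open import Data.Nat.Base using (ℕ; zero; suc; pred; _∸_; _≤_; _<_; _!)
open import Data.Nat.Divisibility using (_∣_; _∣?_)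
open import Data.Nat.Properties using (_≟_; _≤?_; _<?_; _!≢0)
open import Data.Product.Base using (_×_; _,_; ∃-syntax)
open import Data.Rational.Base as ℚ using (ℚ)
open import Data.Rational.Properties using (+-*-commutativeRing)
open import Data.Vec.Base as Vec using (Vec; []; _∷_; concat; count; lookup)
open import Data.Vec.Functional as Vector using (Vector)
open import Data.Vec.Relation.Unary.All using (All; all?)
open import Data.Vec.Relation.Unary.Linked using (Linked; linked?)
open import Function.Base using (_∘_)
open import Level using (Level; 0ℓ)
open import Relation.Binary.PropositionalEquality.Core as ≡ using (_≡_)
open import Relation.Nullary.Decidable using (_×-dec_; _→-dec_; ¬?)
open import Relation.Nullary.Negation using (¬_)
open import Relation.Unary using (Pred; Decidable)

private
  variable
    a ℓ : Level
    k n : ℕ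

module PowerSeries {c ℓ} (R : CommutativeRing c ℓ) where

  private
    module R = CommutativeRing R
    open SemiringSum R.semiring
    open import Relation.Binary.Reasoning.Setoid R.setoid

  Series : Set c
  Series = ℕ → R.Carrier

  infix  4 _≈_
  infixl 6 _+_
  infixl 7 _⊛_
  infix  8 -_ 1/_

  _≈_ : Series → Series → Set ℓ
  f ≈ g = ∀ n → f n R.≈ g n

  _+_ : Series → Series → Series
  (f + g) n = f n R.+ g n

  -_ : Series → Series
  (- f) n = R.- f n

  constant : R.Carrier → Series
  constant a zero    = a
  constant a (suc _) = R.0#

  _⊛_ : Series → Series → Series
  (f ⊛ g) n = ∑[ i ≤ n ] (f (toℕ i) R.* g (n ∸ toℕ i))

  private
    ⊛-cong : ∀ {f f′ g g′} → f ≈ f′ → g ≈ g′ → f ⊛ g ≈ f′ ⊛ g′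
    ⊛-cong {f} {f′} {g} {g′} f≈ g≈ n = sum-cong-≋ {suc n}
      {λ i → f (toℕ i) R.* g (n ∸ toℕ i)} {λ i → f′ (toℕ i) R.* g′ (n ∸ toℕ i)}
      (λ i → R.*-cong (f≈ (toℕ i)) (g≈ (n ∸ toℕ i)))

    ⊛-sucʳ : ∀ f g n → (f ⊛ g) (suc n) R.≈ (f ⊛ (g ∘ suc)) n R.+ f (suc n) R.* g 0
    ⊛-sucʳ f g zero = begin
      f 0 R.* g 1 R.+ (f 1 R.* g 0 R.+ R.0#)   ≈⟨ R.+-congˡ (R.+-identityʳ _) ⟩
      f 0 R.* g 1 R.+ f 1 R.* g 0              ≈⟨ R.+-congʳ (R.+-identityʳ _) ⟨
      (f 0 R.* g 1 R.+ R.0#) R.+ f 1 R.* g 0   ∎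
    ⊛-sucʳ f g (suc n) =
      R.trans (R.+-congˡ (⊛-sucʳ (f ∘ suc) g n)) (R.sym (R.+-assoc _ _ _))

    ⊛-comm : ∀ f g → f ⊛ g ≈ g ⊛ f
    ⊛-comm f g zero    = R.+-congʳ (R.*-comm _ _)
    ⊛-comm f g (suc n) = begin
      f 0 R.* g (suc n) R.+ ((f ∘ suc) ⊛ g) n   ≈⟨ R.+-cong (R.*-comm _ _) (⊛-comm (f ∘ suc) g n) ⟩
      g (suc n) R.* f 0 R.+ (g ⊛ (f ∘ suc)) n   ≈⟨ R.+-comm _ _ ⟩
      (g ⊛ (f ∘ suc)) n R.+ g (suc n) R.* f 0   ≈⟨ ⊛-sucʳ g f n ⟨
      (g ⊛ f) (suc n)                           ∎

    ⊛-distribʳ : ∀ f g h → (g + h) ⊛ f ≈ (g ⊛ f) + (h ⊛ f)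
    ⊛-distribʳ f g h n = R.trans
      (sum-cong-≋ {suc n} {λ i → (g + h) (toℕ i) R.* f (n ∸ toℕ i)}
        (λ i → R.distribʳ (f (n ∸ toℕ i)) (g (toℕ i)) (h (toℕ i))))
      (∑-distrib-+ {suc n} (λ i → g (toℕ i) R.* f (n ∸ toℕ i)) (λ i → h (toℕ i) R.* f (n ∸ toℕ i)))

    ⊛-scale : ∀ r g h n → ((λ m → r R.* g m) ⊛ h) n R.≈ r R.* (g ⊛ h) n
    ⊛-scale r g h n = R.trans
      (sum-cong-≋ {suc n} {λ i → r R.* g (toℕ i) R.* h (n ∸ toℕ i)}
        (λ i → R.*-assoc r (g (toℕ i)) (h (n ∸ toℕ i))))
      (R.sym (*-distribˡ-sum {suc n} r (λ i → g (toℕ i) R.* h (n ∸ toℕ i))))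

    ⊛-assoc : ∀ f g h → (f ⊛ g) ⊛ h ≈ f ⊛ (g ⊛ h)
    ⊛-assoc f g h zero = R.+-congʳ (begin
      (f 0 R.* g 0 R.+ R.0#) R.* h 0     ≈⟨ R.*-congʳ (R.+-identityʳ _) ⟩
      f 0 R.* g 0 R.* h 0                ≈⟨ R.*-assoc _ _ _ ⟩
      f 0 R.* (g 0 R.* h 0)              ≈⟨ R.*-congˡ (R.+-identityʳ _) ⟨
      f 0 R.* (g 0 R.* h 0 R.+ R.0#)     ∎)
    ⊛-assoc f g h (suc n) = begin
      (f 0 R.* g 0 R.+ R.0#) R.* h (suc n) R.+ (((f ⊛ g) ∘ suc) ⊛ h) n
        ≈⟨ R.+-cong (R.*-congʳ (R.+-identityʳ _))
                    (⊛-distribʳ h (λ m → f 0 R.* g (suc m)) ((f ∘ suc) ⊛ g) n) ⟩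
      f 0 R.* g 0 R.* h (suc n) R.+ (((λ m → f 0 R.* g (suc m)) ⊛ h) n R.+ (((f ∘ suc) ⊛ g) ⊛ h) n)
        ≈⟨ R.+-cong (R.*-assoc _ _ _)
                    (R.+-cong (⊛-scale (f 0) (g ∘ suc) h n) (⊛-assoc (f ∘ suc) g h n)) ⟩
      f 0 R.* (g 0 R.* h (suc n)) R.+ (f 0 R.* ((g ∘ suc) ⊛ h) n R.+ ((f ∘ suc) ⊛ (g ⊛ h)) n)
        ≈⟨ R.+-assoc _ _ _ ⟨
      (f 0 R.* (g 0 R.* h (suc n)) R.+ f 0 R.* ((g ∘ suc) ⊛ h) n) R.+ ((f ∘ suc) ⊛ (g ⊛ h)) n
        ≈⟨ R.+-congʳ (R.distribˡ _ _ _) ⟨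
      (f ⊛ (g ⊛ h)) (suc n) ∎

  ⊛-zeroˡ : ∀ g → (λ _ → R.0#) ⊛ g ≈ (λ _ → R.0#)
  ⊛-zeroˡ g n = R.trans
    (sum-cong-≋ {suc n} {λ i → R.0# R.* g (n ∸ toℕ i)} (λ i → R.zeroˡ (g (n ∸ toℕ i))))
    (sum-replicate-zero (suc n))

  private
    ⊛-identityˡ : ∀ f → constant R.1# ⊛ f ≈ f
    ⊛-identityˡ f zero    = R.trans (R.+-identityʳ _) (R.*-identityˡ _)
    ⊛-identityˡ f (suc n) =
      R.trans (R.+-cong (R.*-identityˡ _) (⊛-zeroˡ f n)) (R.+-identityʳ _)

  isCommutativeRing : IsCommutativeRing _≈_ _+_ _⊛_ -_ (λ _ → R.0#) (constant R.1#)
  isCommutativeRing = record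
    { isRing = record
      { +-isAbelianGroup = Pointwise.isAbelianGroup ℕ R.+-isAbelianGroup
      ; *-cong           = ⊛-cong
      ; *-assoc          = ⊛-assoc
      ; *-identity       = ⊛-identityˡ
                         , λ f n → R.trans (⊛-comm f (constant R.1#) n) (⊛-identityˡ f n)
      ; distrib          = (λ f g h n → R.trans (⊛-comm f (g + h) n) (R.trans (⊛-distribʳ f g h n)
                             (R.+-cong (⊛-comm g f n) (⊛-comm h f n))))
                         , ⊛-distribʳ
      }
    ; *-comm = ⊛-comm
    }

  commutativeRing : CommutativeRing c ℓ
  commutativeRing = record { isCommutativeRing = isCommutativeRing }

  -- The coefficients cₙ, …, c₀ (in this order) of the reciprocal of a series b
  -- with constant term 1, from c₀ = 1 and cₙ₊₁ = - ∑_{i ≤ n} bᵢ₊₁ cₙ₋ᵢ.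

  reciprocalUpTo : Series → ∀ n → Vector R.Carrier (suc n)
  reciprocalUpTo b zero    = λ _ → R.1#
  reciprocalUpTo b (suc n) =
    (R.- (∑[ i ≤ n ] (b (suc (toℕ i)) R.* reciprocalUpTo b n i))) Vector.∷ reciprocalUpTo b n

  -- Meaningful only for series with constant term 1: see 1/-inverseʳ.

  1/_ : Series → Series
  (1/ b) n = reciprocalUpTo b n zero

  reciprocalUpTo-1/ : ∀ b n (i : Fin (suc n)) → reciprocalUpTo b n i ≡ (1/ b) (n ∸ toℕ i)
  reciprocalUpTo-1/ b zero    zero    = ≡.refl
  reciprocalUpTo-1/ b (suc n) zero    = ≡.refl
  reciprocalUpTo-1/ b (suc n) (suc i) = reciprocalUpTo-1/ b n i

  1/-inverseʳ : ∀ b → b 0 R.≈ R.1# → b ⊛ 1/ b ≈ constant R.1#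
  1/-inverseʳ b b₀≈1 zero = begin
    b 0 R.* R.1# R.+ R.0#   ≈⟨ R.+-identityʳ _ ⟩
    b 0 R.* R.1#            ≈⟨ R.*-identityʳ _ ⟩
    b 0                     ≈⟨ b₀≈1 ⟩
    R.1#                    ∎
  1/-inverseʳ b b₀≈1 (suc n) = begin
    b 0 R.* (R.- S) R.+ S′   ≈⟨ R.+-congʳ (R.trans (R.*-congʳ b₀≈1) (R.*-identityˡ _)) ⟩
    R.- S R.+ S′             ≈⟨ R.+-congˡ S′≈S ⟩
    R.- S R.+ S              ≈⟨ R.-‿inverseˡ S ⟩
    R.0#                     ∎
    where
    S S′ : R.Carrier
    S  = ∑[ i ≤ n ] (b (suc (toℕ i)) R.* reciprocalUpTo b n i)
    S′ = ∑[ i ≤ n ] (b (suc (toℕ i)) R.* (1/ b) (n ∸ toℕ i))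

    S′≈S : S′ R.≈ S
    S′≈S = sum-cong-≋ {suc n} {λ i → b (suc (toℕ i)) R.* (1/ b) (n ∸ toℕ i)}
      (λ i → R.*-congˡ (R.reflexive (≡.sym (reciprocalUpTo-1/ b n i))))

  -- ∑_{n ≥ 0} cₙ t²ⁿ

  ∑≥0-t²ⁿ : (ℕ → R.Carrier) → Series
  ∑≥0-t²ⁿ c zero          = c 0
  ∑≥0-t²ⁿ c (suc zero)    = R.0#
  ∑≥0-t²ⁿ c (suc (suc m)) = ∑≥0-t²ⁿ (c ∘ suc) m

  -- ∑_{n ≥ 1} cₙ t²ⁿ

  ∑≥1-t²ⁿ : (ℕ → R.Carrier) → Series
  ∑≥1-t²ⁿ c = ∑≥0-t²ⁿ from1
    where
    from1 : ℕ → R.Carrier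
    from1 zero    = R.0#
    from1 (suc n) = c (suc n)

-- Polynomials in x, as lists of coefficients with the constant term first;
-- trailing zeros are immaterial for _≈_.

module Polynomial {c ℓ} (R : CommutativeRing c ℓ) where

  private
    module R = CommutativeRing R
    module R⟦t⟧ = PowerSeries R

  infix  4 _≈_
  infixl 6 _+_
  infixl 7 _⊛_
  infix  8 -_

  coeff : List R.Carrier → ℕ → R.Carrier
  coeff []      _       = R.0#
  coeff (r ∷ p) zero    = r
  coeff (r ∷ p) (suc n) = coeff p n

  _≈_ : List R.Carrier → List R.Carrier → Set ℓ
  p ≈ q = ∀ n → coeff p n R.≈ coeff q n

  _+_ : List R.Carrier → List R.Carrier → List R.Carrier
  []      + q       = q
  (r ∷ p) + []      = r ∷ p
  (r ∷ p) + (s ∷ q) = r R.+ s ∷ p + q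

  -_ : List R.Carrier → List R.Carrier
  - p = List.map R.-_ p

  _⊛_ : List R.Carrier → List R.Carrier → List R.Carrier
  []      ⊛ q = []
  (r ∷ p) ⊛ q = List.map (r R.*_) q + (R.0# ∷ p ⊛ q)

  constant : R.Carrier → List R.Carrier
  constant r = r ∷ []

  X : List R.Carrier
  X = R.0# ∷ R.1# ∷ []

  coeff-+ : ∀ p q n → coeff (p + q) n R.≈ coeff p n R.+ coeff q n
  coeff-+ []      q       n       = R.sym (R.+-identityˡ _)
  coeff-+ (r ∷ p) []      n       = R.sym (R.+-identityʳ _)
  coeff-+ (r ∷ p) (s ∷ q) zero    = R.refl
  coeff-+ (r ∷ p) (s ∷ q) (suc n) = coeff-+ p q n

  coeff-neg : ∀ p n → coeff (- p) n R.≈ R.- coeff p n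
  coeff-neg []      n       = R.trans (R.sym (R.-‿inverseˡ _)) (R.+-identityʳ _)
  coeff-neg (r ∷ p) zero    = R.refl
  coeff-neg (r ∷ p) (suc n) = coeff-neg p n

  coeff-map : ∀ r q n → coeff (List.map (r R.*_) q) n R.≈ r R.* coeff q n
  coeff-map r []      n       = R.sym (R.zeroʳ r)
  coeff-map r (s ∷ q) zero    = R.refl
  coeff-map r (s ∷ q) (suc n) = coeff-map r q n

  coeff-⊛ : ∀ p q → coeff (p ⊛ q) R⟦t⟧.≈ coeff p R⟦t⟧.⊛ coeff q
  coeff-⊛ []      q n       = R.sym (R⟦t⟧.⊛-zeroˡ (coeff q) n)
  coeff-⊛ (r ∷ p) q zero    =
    R.trans (coeff-+ (List.map (r R.*_) q) _ 0) (R.+-congʳ (coeff-map r q 0))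
  coeff-⊛ (r ∷ p) q (suc n) =
    R.trans (coeff-+ (List.map (r R.*_) q) _ (suc n))
            (R.+-cong (coeff-map r q (suc n)) (coeff-⊛ p q n))

  coeff-1 : coeff (constant R.1#) R⟦t⟧.≈ R⟦t⟧.constant R.1#
  coeff-1 zero    = R.refl
  coeff-1 (suc n) = R.refl

  rawRing : RawRing c ℓ
  rawRing = record
    { Carrier = List R.Carrier
    ; _≈_ = _≈_
    ; _+_ = _+_
    ; _*_ = _⊛_
    ; -_  = -_
    ; 0#  = []
    ; 1#  = constant R.1#
    }

  coeff-isRingMonomorphism :
    IsRingMonomorphism rawRing (CommutativeRing.rawRing R⟦t⟧.commutativeRing) coeff
  coeff-isRingMonomorphism = record
    { isRingHomomorphism = record
      { isSemiringHomomorphism = record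
        { isNearSemiringHomomorphism = record
          { +-isMonoidHomomorphism = record
            { isMagmaHomomorphism = record
              { isRelHomomorphism = record { cong = λ p≈q → p≈q }
              ; homo              = coeff-+
              }
            ; ε-homo = λ _ → R.refl
            }
          ; *-homo = coeff-⊛
          }
        ; 1#-homo = coeff-1
        }
      ; -‿homo = coeff-neg
      }
    ; injective = λ p≈q → p≈q
    }

  commutativeRing : CommutativeRing c ℓ
  commutativeRing = record
    { isCommutativeRing =
        RingMonomorphism.isCommutativeRing coeff-isRingMonomorphism R⟦t⟧.isCommutativeRing
    }

module ℚ[x] where
  open CommutativeRing (Polynomial.commutativeRing +-*-commutativeRing) public
  open Polynomial +-*-commutativeRing public using (constant; X)
  open SemiringExp semiring public using (_^_)

  ∑ : {A : Set a} → List A → (A → Carrier) → Carrier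
  ∑ xs f = foldr _+_ 0# (List.map f xs)

module ℚ[x]⟦t⟧ where
  open CommutativeRing (PowerSeries.commutativeRing
                         (Polynomial.commutativeRing +-*-commutativeRing)) public
  open PowerSeries (Polynomial.commutativeRing +-*-commutativeRing) public
    using (1/_; 1/-inverseʳ; ∑≥1-t²ⁿ)

  1-∑-inverseʳ : ∀ c → (1# - ∑≥1-t²ⁿ c) * 1/ (1# - ∑≥1-t²ⁿ c) ≈ 1#
  1-∑-inverseʳ c = 1/-inverseʳ (1# - ∑≥1-t²ⁿ c) (ℚ[x].+-identityʳ ℚ[x].1#)

open import Data.Nat.Base using (_*_)

infix 7 _/[_]!

_/[_]! : ℕ → ℕ → ℚ
i /[ m ]! = (+ i ℚ./ m !) {{m !≢0}}

-- k rows and n columns; an array is the vector of its columns, and each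
-- column is read from bottom to top.

Array : ℕ → ℕ → Set
Array k n = Vec (Vec ℕ k) n

Filling : Pred (Array k n) 0ℓ
Filling {k} {n} F
  = All (All (λ v → 1 ≤ v × v ≤ k * n)) F
  × (∀ (i : Fin (k * n)) → count (suc (toℕ i) ≟_) (concat F) ≡ 1)
  × All (Linked _<_) F

filling? : Decidable (Filling {k} {n})
filling? {k} {n} F
  =     all? (all? (λ v → 1 ≤? v ×-dec v ≤? k * n)) F
  ×-dec Fin.all? (λ i → count (suc (toℕ i) ≟_) (concat F) ≟ 1)
  ×-dec all? (linked? _<?_) F

words : {A : Set a} → List A → ∀ n → List (Vec A n)
words xs zero    = [] ∷ []
words xs (suc n) = cartesianProductWith _∷_ xs (words xs n)

[1⋯_] : ℕ → List ℕ
[1⋯ m ] = applyUpTo suc m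

fillings : ∀ k n → List (Array k n)
fillings k n = filter filling? (words (words [1⋯ k * n ] k) n)

-- When the entries of F are distinct, v is the i-th smallest of them exactly
-- when i of them are ≤ v.

red : Array k n → Array k n
red F = Vec.map (Vec.map (λ v → count (_≤? v) (concat F))) F

-- Positions are numbered from 1, so i : Fin (pred n) is the position 1 + i.

columnPair : Array k n → Fin (pred n) → Array k 2
columnPair {n = suc _} F i = lookup F (inject₁ i) ∷ lookup F (suc i) ∷ []

MatchAt : Pred (Array k 2) ℓ → Array k n → Pred (Fin (pred n)) ℓ
MatchAt Υ F i = Υ (red (columnPair F i))

S : Pred (Array k 2) ℓ → Array k n → Pred ℕ ℓ
S {n = n} Υ F j = ∃[ i ] suc (toℕ {pred n} i) ≡ j × MatchAt Υ F i

MatchesAtOdd : Pred (Array k 2) ℓ → Pred (Array k n) ℓ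
MatchesAtOdd {n = n} Υ F = ∀ (i : Fin n) → ¬ (2 ∣ suc (toℕ i)) → S Υ F (suc (toℕ i))

MatchesEverywhere : Pred (Array k 2) ℓ → Pred (Array k n) ℓ
MatchesEverywhere Υ F = ∀ i → MatchAt Υ F i

module _ {Υ : Pred (Array k 2) ℓ} (Υ? : Decidable Υ) where

  S? : (F : Array k n) → Decidable (S Υ F)
  S? F j = Fin.any? (λ i → suc (toℕ i) ≟ j ×-dec Υ? (red (columnPair F i)))

  matchesAtOdd? : Decidable (MatchesAtOdd {n = n} Υ)
  matchesAtOdd? F = Fin.all? (λ i → ¬? (2 ∣? suc (toℕ i)) →-dec S? F (suc (toℕ i)))

  matchesEverywhere? : Decidable (MatchesEverywhere {n = n} Υ)
  matchesEverywhere? F = Fin.all? (λ i → Υ? (red (columnPair F i)))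

  fillings⁽²⁾ : ∀ n → List (Array k (2 * n))
  fillings⁽²⁾ n = filter matchesAtOdd? (fillings k (2 * n))

  -- The range loses nothing: 2i ∈ S Υ F forces 1 ≤ i < n.

  mch⁽²⁾ : Array k n → ℕ
  mch⁽²⁾ {n = n} F = length (filter (λ i → S? F (2 * i)) [1⋯ n ])

  full : ℕ → ℕ
  full n = length (filter matchesEverywhere? (fillings k n))

module Submission where

-- Let y = x - 1.  Cut a filling F with 2n columns into n consecutive pairs of
-- columns, and suppose that it matches inside every pair (at the odd positions).
-- Then x to the number of matches between pairs (at the even positions) is a
-- product over the n - 1 gaps of 1 + [match] y.  Expand the leading factors of
-- this product up to the first gap at which the term 1 is chosen: if that gap
-- follows the pair number j, then F matches at every position of its first 2j
-- columns, these contribute y^(j-1), and what is left is the weight of the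
-- remaining 2(n-j) columns; j = n if there is no such gap (pairedWeight-cut).
--
-- The weights of the two parts depend only on the relative order of the entries
-- of each part, and a filling of p + q columns amounts to a choice of the kp
-- entries of its first p columns together with a filling of p and a filling of
-- q columns (∑-fillings-+).  So the sum over all fillings splits with a factor
-- binomial(k(p+q), kp), which the division by factorials absorbs (egfCoeff-*).
-- With a(n) and b(n) the coefficients of t^(2n) in the two sums of the theorem
-- and a(0) = 1, this is the recurrence
--   a(n+1) = sum over i from 0 to n of b(i+1) a(n-i)    (egfCoeff-pairedWeight),
-- which says (1 - sum of b(n) t^(2n)) (1 + sum of a(n) t^(2n)) = 1
-- (1+∑≥1-t²ⁿ-reciprocal).
--
-- To make the splitting of fillings computable, the list of fillings is first
-- shown to be a permutation of the list of arrangements, which are built column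
-- by column by choosing the set of entries of a column among the entries that
-- are still unused (fillings↭arrangements).  Splitting arrangements is then a
-- matter of coassociativity of the choice of subsets (∑-splits-assoc).

open import Defs
open import Algebra.Bundles using (CommutativeRing)
import Algebra.Properties.CommutativeSemigroup as CommutativeSemigroupProperties
import Algebra.Properties.Ring as RingProperties
import Algebra.Properties.Semiring.Exp as SemiringExp
import Algebra.Properties.Semiring.Mult as SemiringMult
import Algebra.Properties.Semiring.Sum as SemiringSum
import Algebra.Solver.Ring.NaturalCoefficients.Default as SemiringSolver
open import Data.Bool.Base using (Bool; true; false; if_then_else_; _∧_)
open import Data.Empty using (⊥)
open import Data.Fin.Base as Fin using (Fin; toℕ; fromℕ<; zero; suc)
import Data.Fin.Properties as Fin
open import Data.Integer.Base as ℤ using ()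
import Data.Integer.Properties as ℤ
open import Data.List.Base as List
  using (List; []; _∷_; _++_; allFin; applyUpTo; concatMap; drop; filter; foldr; length; map; take)
import Data.List.Properties as List
open import Data.List.Membership.Propositional using (_∈_)
open import Data.List.Membership.Propositional.Properties
open import Data.List.Membership.Propositional.Properties.WithK using (unique∧set⇒bag)
open import Data.List.Relation.Binary.BagAndSetEquality using (∼bag⇒↭)
open import Data.List.Relation.Binary.Permutation.Propositional as ↭ using (_↭_)
open import Data.List.Relation.Unary.All as All using (All; []; _∷_)
import Data.List.Relation.Unary.All.Properties as All
open import Data.List.Relation.Unary.AllPairs as AllPairs using (AllPairs; []; _∷_)
import Data.List.Relation.Unary.AllPairs.Properties as AllPairs
open import Data.List.Relation.Unary.Any using (here; there)
open import Data.List.Relation.Unary.Unique.Propositional using (Unique)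
import Data.List.Relation.Unary.Unique.Propositional.Properties as Unique
open import Data.Nat.Base as ℕ using (ℕ; zero; suc; _≤_; _<_; s≤s; z≤n; _∸_; _!)
open import Data.Nat.Combinatorics
  using (_C_; nCk≡n!/k![n-k]!; nCk+nC[k+1]≡[n+1]C[k+1]; k![n∸k]!∣n!)
open import Data.Nat.Divisibility using (_∣_; ∣1⇒≡1; ∣m∣n⇒∣m+n; ∣m+n∣m⇒∣n; ∣-refl)
open import Data.Nat.DivMod using (m/n*n≡m)
import Data.Nat.Properties as ℕ
open import Data.Product.Base as Product using (_×_; _,_; proj₁; proj₂; ∃; map₁; map₂)
open import Data.Rational.Base as ℚ using (0ℚ; 1ℚ; toℚᵘ)
import Data.Rational.Properties as ℚ
open import Data.Rational.Unnormalised.Base as ℚᵘ using (mkℚᵘ; *≡*)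
import Data.Rational.Unnormalised.Properties as ℚᵘ
open import Data.Vec.Base as Vec using (Vec; []; _∷_; concat; count; fromList; toList)
import Data.Vec.Properties as Vec
open import Data.Vec.Relation.Unary.All as VAll using ([]; _∷_) renaming (All to VAll)
import Data.Vec.Relation.Unary.All.Properties as VAll
open import Data.Vec.Relation.Unary.Linked using (Linked; []; [-]; _∷_)
open import Data.Vec.Relation.Unary.Linked.Properties using (Linked⇒All)
open import Function.Base using (_∘_; id)
open import Function.Bundles using (_⇔_; mk⇔; module Equivalence)
open import Level using (Level; 0ℓ)
open import Relation.Binary.Core using (Rel)
open import Relation.Binary.PropositionalEquality as ≡ using (_≡_; _≢_; cong; cong₂; subst; subst₂)
import Relation.Binary.Reasoning.Setoid as SetoidReasoning
open import Relation.Nullary.Decidable using (yes; no; does; does-⇔; dec-false; _×-dec_)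
open import Relation.Nullary.Negation using (¬_; contradiction)
open import Relation.Unary using (Pred; Decidable; _⊆_)

-- Choosing subsets, and building fillings column by column

module _ where
  open import Data.Nat.Base using (_+_; _*_)
  open import Data.Nat.Properties using (_≟_; _≤?_; ≤-reflexive; ≤-trans; <⇒≢; <-trans; m≤m+n; +-assoc;
    +-comm; +-suc; *-comm;
    +-cancelˡ-≡; +-cancelˡ-≤; _!*_!≢0)
  open import Data.Fin.Properties using (toℕ<n; toℕ-fromℕ<)
  open import Relation.Binary.PropositionalEquality using (refl; sym; trans; module ≡-Reasoning)

  -- All ways to choose a entries of a list: the chosen entries and the remaining
  -- ones, both in the order of the list.
  splits : {A : Set} (a : ℕ) → List A → List (Vec A a × List A)
  splits zero    xs       = ([] , xs) ∷ []
  splits (suc a) []       = []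
  splits (suc a) (x ∷ xs) =
    map (map₁ (x ∷_)) (splits a xs) ++ map (map₂ (x ∷_)) (splits (suc a) xs)

  -- Arrays of n columns of k entries from a list, without repetition of positions,
  -- where every column keeps the order of the list.  The entries that are left after
  -- n columns are ignored, so a list of n * k entries is the case of interest.
  arrangements : {A : Set} (k n : ℕ) → List A → List (Vec (Vec A k) n)
  arrangements k zero    xs = [] ∷ []
  arrangements k (suc n) xs =
    concatMap (λ p → map (proj₁ p ∷_) (arrangements k n (proj₂ p))) (splits k xs)

  -- The number of occurrences of v in a list.
  occ : ℕ → List ℕ → ℕ
  occ v xs = count (v ≟_) (fromList xs)

  splits-all : {A : Set} {P : A → Set} (a : ℕ) {xs : List A} → All P xs →
    All (λ p → All P (toList (proj₁ p)) × All P (proj₂ p)) (splits a xs)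
  splits-all zero    pxs        = ([] , pxs) ∷ []
  splits-all (suc a) []         = []
  splits-all (suc a) (px ∷ pxs) = All.++⁺
    (All.map⁺ (All.map (map₁ (px ∷_)) (splits-all a pxs)))
    (All.map⁺ (All.map (map₂ (px ∷_)) (splits-all (suc a) pxs)))

  splits-allPairs : {A : Set} {R : Rel A 0ℓ} (a : ℕ) {xs : List A} → AllPairs R xs →
    All (λ p → AllPairs R (toList (proj₁ p)) × AllPairs R (proj₂ p)) (splits a xs)
  splits-allPairs zero    rxs        = ([] , rxs) ∷ []
  splits-allPairs (suc a) []         = []
  splits-allPairs (suc a) (rx ∷ rxs) = All.++⁺
    (All.map⁺ (All.zipWith (λ ((rs , _) , (ss , ts)) → rs ∷ ss , ts)
      (splits-all a rx , splits-allPairs a rxs)))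
    (All.map⁺ (All.zipWith (λ ((_ , rt) , (ss , ts)) → ss , rt ∷ ts)
      (splits-all (suc a) rx , splits-allPairs (suc a) rxs)))

  splits-length : {A : Set} (a : ℕ) (xs : List A) →
    All (λ p → a + length (proj₂ p) ≡ length xs) (splits a xs)
  splits-length zero    xs       = refl ∷ []
  splits-length (suc a) []       = []
  splits-length (suc a) (x ∷ xs) = All.++⁺
    (All.map⁺ (All.map (cong suc) (splits-length a xs)))
    (All.map⁺ (All.map (λ eq → trans (+-suc (suc a) _) (cong suc eq)) (splits-length (suc a) xs)))

  count-∷ : {A : Set} {P : Pred A 0ℓ} (P? : Decidable P) (x : A) {n : ℕ} (xs : Vec A n) →
    count P? (x ∷ xs) ≡ (if does (P? x) then 1 else 0) + count P? xs
  count-∷ P? x xs with does (P? x)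
  ... | true  = refl
  ... | false = refl

  count-accept : {A : Set} {P : Pred A 0ℓ} (P? : Decidable P) {x : A} {n : ℕ} (xs : Vec A n) →
    P x → count P? (x ∷ xs) ≡ suc (count P? xs)
  count-accept P? {x} xs px with P? x
  ... | yes _  = refl
  ... | no ¬px = contradiction px ¬px

  count-reject : {A : Set} {P : Pred A 0ℓ} (P? : Decidable P) {x : A} {n : ℕ} (xs : Vec A n) →
    ¬ P x → count P? (x ∷ xs) ≡ count P? xs
  count-reject P? {x} xs ¬px with P? x
  ... | yes px = contradiction px ¬px
  ... | no _   = refl

  count-++ : {A : Set} {P : Pred A 0ℓ} (P? : Decidable P) {m n : ℕ} (xs : Vec A m) (ys : Vec A n) →
    count P? (xs Vec.++ ys) ≡ count P? xs + count P? ys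
  count-++ P? []       ys = refl
  count-++ P? (x ∷ xs) ys with does (P? x)
  ... | true  = cong suc (count-++ P? xs ys)
  ... | false = count-++ P? xs ys

  splits-occ : (v a : ℕ) (xs : List ℕ) →
    All (λ p → count (v ≟_) (proj₁ p) + occ v (proj₂ p) ≡ occ v xs) (splits a xs)
  splits-occ v zero    xs       = refl ∷ []
  splits-occ v (suc a) []       = []
  splits-occ v (suc a) (x ∷ xs) = All.++⁺
    (All.map⁺ (All.map (λ {p} → left p) (splits-occ v a xs)))
    (All.map⁺ (All.map (λ {p} → right p) (splits-occ v (suc a) xs)))
    where
    open ≡-Reasoning

    δ : ℕ
    δ = if does (v ≟ x) then 1 else 0

    left : (p : Vec ℕ a × List ℕ) → count (v ≟_) (proj₁ p) + occ v (proj₂ p) ≡ occ v xs →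
      count (v ≟_) (x ∷ proj₁ p) + occ v (proj₂ p) ≡ occ v (x ∷ xs)
    left (S , T) eq = begin
      count (v ≟_) (x ∷ S) + occ v T   ≡⟨ cong (_+ occ v T) (count-∷ (v ≟_) x S) ⟩
      δ + count (v ≟_) S + occ v T     ≡⟨ +-assoc δ _ _ ⟩
      δ + (count (v ≟_) S + occ v T)   ≡⟨ cong (δ +_) eq ⟩
      δ + occ v xs                     ≡⟨ count-∷ (v ≟_) x (fromList xs) ⟨
      occ v (x ∷ xs)                   ∎

    right : (p : Vec ℕ (suc a) × List ℕ) → count (v ≟_) (proj₁ p) + occ v (proj₂ p) ≡ occ v xs →
      count (v ≟_) (proj₁ p) + occ v (x ∷ proj₂ p) ≡ occ v (x ∷ xs)
    right (S , T) eq = begin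
      c + occ v (x ∷ T)     ≡⟨ cong (c +_) (count-∷ (v ≟_) x (fromList T)) ⟩
      c + (δ + occ v T)     ≡⟨ +-assoc c δ _ ⟨
      c + δ + occ v T       ≡⟨ cong (_+ occ v T) (+-comm c δ) ⟩
      δ + c + occ v T       ≡⟨ +-assoc δ c _ ⟩
      δ + (c + occ v T)     ≡⟨ cong (δ +_) eq ⟩
      δ + occ v xs          ≡⟨ count-∷ (v ≟_) x (fromList xs) ⟨
      occ v (x ∷ xs)        ∎
      where
      c : ℕ
      c = count (v ≟_) S

  length-splits : {A : Set} (a : ℕ) (xs : List A) → length (splits a xs) ≡ length xs C a
  length-splits zero    xs       = refl
  length-splits (suc a) []       = refl
  length-splits (suc a) (x ∷ xs) = begin
    length (map (map₁ (x ∷_)) (splits a xs) ++ map (map₂ (x ∷_)) (splits (suc a) xs))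
      ≡⟨ List.length-++ (map _ (splits a xs)) ⟩
    length (map (map₁ (x ∷_)) (splits a xs)) + length (map (map₂ (x ∷_)) (splits (suc a) xs))
      ≡⟨ cong₂ _+_ (List.length-map _ (splits a xs)) (List.length-map _ (splits (suc a) xs)) ⟩
    length (splits a xs) + length (splits (suc a) xs)
      ≡⟨ cong₂ _+_ (length-splits a xs) (length-splits (suc a) xs) ⟩
    length xs C a + length xs C suc a
      ≡⟨ nCk+nC[k+1]≡[n+1]C[k+1] (length xs) a ⟩
    suc (length xs) C suc a ∎
    where open ≡-Reasoning

  nCk*k![n∸k]!≡n! : ∀ {n k} → k ≤ n → (n C k) * (k ! * (n ∸ k) !) ≡ n !
  nCk*k![n∸k]!≡n! {n} {k} k≤n = trans
    (cong (_* (k ! * (n ∸ k) !)) (nCk≡n!/k![n-k]! k≤n))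
    (m/n*n≡m (k![n∸k]!∣n! k≤n))
    where instance _ = k !* (n ∸ k) !≢0


  -- Only the chosen entries are compared: they determine the choice.
  splits-distinct : {A : Set} (a : ℕ) {xs : List A} → Unique xs →
    AllPairs (λ p q → proj₁ p ≢ proj₁ q) (splits a xs)
  splits-distinct zero    u        = [] ∷ []
  splits-distinct (suc a) []       = []
  splits-distinct (suc a) {x ∷ xs} (x∉ ∷ u) = AllPairs.++⁺
    (AllPairs.map⁺ (AllPairs.map (λ ≢ eq → ≢ (Vec.∷-injectiveʳ eq)) (splits-distinct a u)))
    (AllPairs.map⁺ (splits-distinct (suc a) u))
    (All.map⁺ (All.universal (λ p → All.map⁺ (All.map (λ {q} → heads p q) (splits-all (suc a) x∉)))
      (splits a xs)))
    where
    heads : (p : Vec _ a × List _) (q : Vec _ (suc a) × List _) →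
      All (x ≢_) (toList (proj₁ q)) × All (x ≢_) (proj₂ q) → x ∷ proj₁ p ≢ proj₁ q
    heads p (y ∷ _ , _) (x≢y ∷ _ , _) eq = x≢y (Vec.∷-injectiveˡ eq)

  arrangements-unique : {A : Set} (k n : ℕ) {xs : List A} → Unique xs →
    Unique (arrangements k n xs)
  arrangements-unique k zero    u = [] ∷ []
  arrangements-unique k (suc n) {xs} u = Unique.concat⁺
    (All.map⁺ (All.map (λ (_ , t) → Unique.map⁺ Vec.∷-injectiveʳ (arrangements-unique k n t))
      (splits-allPairs k u)))
    (AllPairs.map⁺ (AllPairs.map (λ {p} {q} → disjoint p q) (splits-distinct k u)))
    where
    disjoint : ∀ p q → proj₁ p ≢ proj₁ q → ∀ {F} →
      ¬ (F ∈ map (proj₁ p ∷_) (arrangements k n (proj₂ p)) ×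
         F ∈ map (proj₁ q ∷_) (arrangements k n (proj₂ q)))
    disjoint p q ≢ (∈p , ∈q) with ∈-map⁻ _ ∈p | ∈-map⁻ _ ∈q
    ... | _ , _ , refl | _ , _ , eq = ≢ (Vec.∷-injectiveˡ eq)

  allPairs⇒linked : {A : Set} {R : Rel A 0ℓ} {n : ℕ} (xs : Vec A n) →
    AllPairs R (toList xs) → Linked R xs
  allPairs⇒linked []           _                = []
  allPairs⇒linked (x ∷ [])     _                = [-]
  allPairs⇒linked (x ∷ y ∷ xs) ((r ∷ _) ∷ rs) = r ∷ allPairs⇒linked (y ∷ xs) rs

  arrangements-all : {A : Set} {P : A → Set} (k n : ℕ) {xs : List A} → All P xs →
    All (VAll (VAll P)) (arrangements k n xs)
  arrangements-all k zero    pxs = [] ∷ []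
  arrangements-all k (suc n) pxs = All.concat⁺ (All.map⁺ (All.map
    (λ (s , t) → All.map⁺ (All.map (VAll.toList⁻ s ∷_) (arrangements-all k n t)))
    (splits-all k pxs)))

  arrangements-linked : (k n : ℕ) {xs : List ℕ} → AllPairs _<_ xs →
    All (VAll (Linked _<_)) (arrangements k n xs)
  arrangements-linked k zero    xs↗ = [] ∷ []
  arrangements-linked k (suc n) xs↗ = All.concat⁺ (All.map⁺ (All.map
    (λ {p} (s , t) → All.map⁺ (All.map (allPairs⇒linked (proj₁ p) s ∷_) (arrangements-linked k n t)))
    (splits-allPairs k xs↗)))

  arrangements-occ : (v k n : ℕ) (xs : List ℕ) → length xs ≡ n * k →
    All (λ F → count (v ≟_) (concat F) ≡ occ v xs) (arrangements k n xs)
  arrangements-occ v k zero    []  eq = refl ∷ []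
  arrangements-occ v k (suc n) xs  eq = All.concat⁺ (All.map⁺ (All.zipWith
    (λ {p} (o , l) → All.map⁺ (All.map
      (λ {F} e → trans (count-++ (v ≟_) (proj₁ p) (concat F)) (trans (cong (_ +_) e) o))
      (arrangements-occ v k n (proj₂ p) (+-cancelˡ-≡ k _ _ (trans l eq)))))
    (splits-occ v k xs , splits-length k xs)))

  occ-none : (v : ℕ) {n : ℕ} {xs : Vec ℕ n} → VAll (v ≢_) xs → count (v ≟_) xs ≡ 0
  occ-none v []                           = refl
  occ-none v {xs = x ∷ xs} (v≢x ∷ v≢xs) =
    trans (count-reject (v ≟_) xs v≢x) (occ-none v v≢xs)

  occ-some : {P : ℕ → Set} (v : ℕ) {xs : List ℕ} → All P xs → 1 ≤ occ v xs → P v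
  occ-some v {x ∷ xs} (px ∷ pxs) 1≤ with v ≟ x
  ... | yes refl = px
  ... | no  v≢x  = occ-some v pxs (subst (1 ≤_) (count-reject (v ≟_) (fromList xs) v≢x) 1≤)

  -- A strictly increasing column whose entries all occur in a strictly increasing
  -- list can be chosen from it.
  splits-complete : (a : ℕ) {xs : List ℕ} → AllPairs _<_ xs → (S : Vec ℕ a) → Linked _<_ S →
    (∀ v → count (v ≟_) S ≤ occ v xs) → ∃ λ T → (S , T) ∈ splits a xs
  splits-complete zero    {xs}     xs↗         []      S↗ occ≤ = xs , here refl
  splits-complete (suc a) {[]}     xs↗         (s ∷ S) S↗ occ≤ =
    contradiction (subst (_≤ 0) (count-accept (s ≟_) S refl) (occ≤ s)) λ ()
  -- When s differs from x it occurs in xs, so x < s and x is not in the column.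
  splits-complete (suc a) {x ∷ xs} (x< ∷ xs↗) (s ∷ S) S↗ occ≤ with s ≟ x
  ... | yes refl =
    Product.map₂ (∈-++⁺ˡ ∘ ∈-map⁺ _) (splits-complete a xs↗ S (tail S↗)
      (λ v → +-cancelˡ-≤ (if does (v ≟ s) then 1 else 0) _ _
        (subst₂ _≤_ (count-∷ (v ≟_) s S) (count-∷ (v ≟_) s (fromList xs)) (occ≤ v))))
    where
    tail : ∀ {n x} {ys : Vec ℕ n} → Linked _<_ (x ∷ ys) → Linked _<_ ys
    tail [-]      = []
    tail (_ ∷ ys) = ys
  ... | no s≢x =
    Product.map (x ∷_) (∈-++⁺ʳ (map _ (splits a xs)) ∘ ∈-map⁺ _)
      (splits-complete (suc a) xs↗ (s ∷ S) S↗ bound)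
    where
    s∈xs : 1 ≤ occ s xs
    s∈xs = ≤-trans (s≤s z≤n) (subst₂ _≤_ (count-accept (s ≟_) S refl) (count-reject (s ≟_) (fromList xs) s≢x)
      (occ≤ s))

    bound : ∀ v → count (v ≟_) (s ∷ S) ≤ occ v xs
    bound v with v ≟ x
    ... | yes refl = ≤-trans (≤-reflexive (occ-none v
      (VAll.map <⇒≢ (Linked⇒All <-trans (occ-some s x< s∈xs) S↗)))) z≤n
    ... | no v≢x   = subst (_ ≤_) (count-reject (v ≟_) (fromList xs) v≢x) (occ≤ v)

  -- An inequality of multiplicities suffices: the columns together use no entry
  -- more often than the list supplies it.
  arrangements-complete : (k n : ℕ) {xs : List ℕ} → AllPairs _<_ xs → (F : Array k n) →
    VAll (Linked _<_) F → (∀ v → count (v ≟_) (concat F) ≤ occ v xs) → F ∈ arrangements k n xs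
  arrangements-complete k zero    xs↗ []      _          _    = here refl
  arrangements-complete k (suc n) {xs} xs↗ (S ∷ F) (S↗ ∷ F↗) occ≤ =
    ∈-concat⁺′ (∈-map⁺ (S ∷_) F∈) (∈-map⁺ _ S,T∈)
    where
    split : ∃ λ T → (S , T) ∈ splits k xs
    split = splits-complete k xs↗ S S↗ (λ v → ≤-trans (m≤m+n _ _)
      (subst (_≤ occ v xs) (count-++ (v ≟_) S (concat F)) (occ≤ v)))

    T : List ℕ
    T = proj₁ split

    S,T∈ : (S , T) ∈ splits k xs
    S,T∈ = proj₂ split

    F∈ : F ∈ arrangements k n T
    F∈ = arrangements-complete k n (proj₂ (All.lookup (splits-allPairs k xs↗) S,T∈)) F F↗
      (λ v → +-cancelˡ-≤ (count (v ≟_) S) _ _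
        (subst₂ _≤_ (count-++ (v ≟_) S (concat F)) (sym (All.lookup (splits-occ v k xs) S,T∈)) (occ≤ v)))

  words-complete : {A : Set} {xs : List A} {n : ℕ} {w : Vec A n} →
    VAll (_∈ xs) w → w ∈ words xs n
  words-complete []         = here refl
  words-complete (x∈ ∷ w∈) = ∈-cartesianProductWith⁺ _∷_ x∈ (words-complete w∈)

  words-unique : {A : Set} {xs : List A} → Unique xs → (n : ℕ) → Unique (words xs n)
  words-unique u zero    = [] ∷ []
  words-unique u (suc n) = Unique.cartesianProductWith⁺ _∷_ Vec.∷-injective u (words-unique u n)

  [1⋯]-increasing : (m : ℕ) → AllPairs _<_ [1⋯ m ]
  [1⋯]-increasing m = AllPairs.applyUpTo⁺₁ suc m (λ i<j _ → s≤s i<j)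

  [1⋯]-range : (m : ℕ) → All (λ v → 1 ≤ v × v ≤ m) [1⋯ m ]
  [1⋯]-range m = All.applyUpTo⁺₁ suc m (λ i<m → s≤s z≤n , i<m)

  ∈-[1⋯] : {m v : ℕ} → 1 ≤ v × v ≤ m → v ∈ [1⋯ m ]
  ∈-[1⋯] {v = suc v} (_ , v<m) = ∈-applyUpTo⁺ suc v<m

  occ-unique : {v : ℕ} {xs : List ℕ} → Unique xs → v ∈ xs → occ v xs ≡ 1
  occ-unique {v} {x ∷ xs} (x∉ ∷ u) (here refl) = trans
    (count-accept (v ≟_) (fromList xs) refl) (cong suc (occ-none v (VAll.fromList⁺ x∉)))
  occ-unique {v} {x ∷ xs} (x∉ ∷ u) (there v∈)  = trans
    (count-reject (v ≟_) (fromList xs) (All.lookup x∉ v∈ ∘ sym)) (occ-unique u v∈)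

  -- Both lists are free of repetitions and have the same members.
  fillings↭arrangements : (k n : ℕ) → fillings k n ↭ arrangements k n [1⋯ k * n ]
  fillings↭arrangements k n = ∼bag⇒↭ (unique∧set⇒bag
    (Unique.filter⁺ filling? (words-unique (words-unique uniq k) n))
    (arrangements-unique k n uniq)
    (mk⇔ to from))
    where
    m : ℕ
    m = k * n

    uniq : Unique [1⋯ m ]
    uniq = AllPairs.map <⇒≢ ([1⋯]-increasing m)

    to : ∀ {F} → F ∈ fillings k n → F ∈ arrangements k n [1⋯ m ]
    to {F} F∈ with ∈-filter⁻ filling? {xs = words (words [1⋯ m ] k) n} F∈
    ... | _ , range , once , F↗ = arrangements-complete k n ([1⋯]-increasing m) F F↗ occ≤
      where
      occ≤ : ∀ v → count (v ≟_) (concat F) ≤ occ v [1⋯ m ]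
      occ≤ v with 1 ≤? v ×-dec v ≤? m
      ... | no out = ≤-trans (≤-reflexive (occ-none v
        (VAll.map (λ r eq → out (subst (λ u → 1 ≤ u × u ≤ m) (sym eq) r)) (VAll.concat⁺ range)))) z≤n
      occ≤ (suc w) | yes (_ , w<m) = ≤-reflexive (trans
        (subst (λ u → count (suc u ≟_) (concat F) ≡ 1) (toℕ-fromℕ< w<m) (once (fromℕ< w<m)))
        (sym (occ-unique uniq (∈-[1⋯] (s≤s z≤n , w<m)))))

    from : ∀ {F} → F ∈ arrangements k n [1⋯ m ] → F ∈ fillings k n
    from {F} F∈ = ∈-filter⁺ filling?
      (words-complete (VAll.map (λ r → words-complete (VAll.map ∈-[1⋯] r)) range))
      (range , once , All.lookup (arrangements-linked k n ([1⋯]-increasing m)) F∈)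
      where
      range : VAll (VAll (λ v → 1 ≤ v × v ≤ m)) F
      range = All.lookup (arrangements-all k n ([1⋯]-range m)) F∈

      once : ∀ (i : Fin m) → count (suc (toℕ i) ≟_) (concat F) ≡ 1
      once i = trans
        (All.lookup (arrangements-occ _ k n [1⋯ m ]
          (trans (List.length-applyUpTo suc m) (*-comm k n))) F∈)
        (occ-unique uniq (∈-[1⋯] (s≤s z≤n , toℕ<n i)))

-- Invariance under order isomorphism

splits-map : {A B : Set} (f : A → B) (a : ℕ) (xs : List A) →
  splits a (map f xs) ≡ map (Product.map (Vec.map f) (map f)) (splits a xs)
splits-map f zero    xs       = ≡.refl
splits-map f (suc a) []       = ≡.refl
splits-map f (suc a) (x ∷ xs) = begin
  map (map₁ (f x ∷_)) (splits a (map f xs)) ++ map (map₂ (f x ∷_)) (splits (suc a) (map f xs))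
    ≡⟨ cong₂ (λ ps qs → map (map₁ (f x ∷_)) ps ++ map (map₂ (f x ∷_)) qs)
         (splits-map f a xs) (splits-map f (suc a) xs) ⟩
  map (map₁ (f x ∷_)) (map f² (splits a xs)) ++ map (map₂ (f x ∷_)) (map f² (splits (suc a) xs))
    ≡⟨ cong₂ _++_ (≡.trans (≡.sym (List.map-∘ (splits a xs))) (List.map-∘ (splits a xs)))
                  (≡.trans (≡.sym (List.map-∘ (splits (suc a) xs))) (List.map-∘ (splits (suc a) xs))) ⟩
  map f² (map (map₁ (x ∷_)) (splits a xs)) ++ map f² (map (map₂ (x ∷_)) (splits (suc a) xs))
    ≡⟨ List.map-++ f² (map (map₁ (x ∷_)) (splits a xs)) _ ⟨
  map f² (splits (suc a) (x ∷ xs)) ∎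
  where
  open ≡.≡-Reasoning
  f² : ∀ {n} → Vec _ n × List _ → Vec _ n × List _
  f² = Product.map (Vec.map f) (map f)

arrangements-map : {A B : Set} (f : A → B) (k n : ℕ) (xs : List A) →
  arrangements k n (map f xs) ≡ map (Vec.map (Vec.map f)) (arrangements k n xs)
arrangements-map f k zero    xs = ≡.refl
arrangements-map f k (suc n) xs = begin
  concatMap step (splits k (map f xs))
    ≡⟨ cong (concatMap step) (splits-map f k xs) ⟩
  concatMap step (map (Product.map (Vec.map f) (map f)) (splits k xs))
    ≡⟨ List.concatMap-map step _ (splits k xs) ⟩
  concatMap (λ p → map (Vec.map f (proj₁ p) ∷_) (arrangements k n (map f (proj₂ p)))) (splits k xs)
    ≡⟨ List.concatMap-cong (λ p → ≡.trans
         (cong (map (Vec.map f (proj₁ p) ∷_)) (arrangements-map f k n (proj₂ p)))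
         (≡.trans (≡.sym (List.map-∘ (arrangements k n (proj₂ p)))) (List.map-∘ (arrangements k n (proj₂ p)))))
         (splits k xs) ⟩
  concatMap (map (Vec.map (Vec.map f)) ∘ step) (splits k xs)
    ≡⟨ List.map-concatMap (Vec.map (Vec.map f)) step (splits k xs) ⟨
  map (Vec.map (Vec.map f)) (concatMap step (splits k xs)) ∎
  where
  open ≡.≡-Reasoning
  step : ∀ {X : Set} → Vec X k × List X → List (Vec (Vec X k) (suc n))
  step p = map (proj₁ p ∷_) (arrangements k n (proj₂ p))

-- Strictly increasing functions.
Increasing : {m : ℕ} → (Fin m → ℕ) → Set
Increasing f = ∀ {i j} → i Fin.< j → f i < f j

increasing-reflects-≤ : {m : ℕ} {f : Fin m → ℕ} → Increasing f → ∀ {i j} → f i ≤ f j → i Fin.≤ j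
increasing-reflects-≤ f↗ fi≤fj = ℕ.≮⇒≥ (λ j<i → ℕ.<⇒≱ (f↗ j<i) fi≤fj)

increasing-preserves-≤ : {m : ℕ} {f : Fin m → ℕ} → Increasing f → ∀ {i j} → i Fin.≤ j → f i ≤ f j
increasing-preserves-≤ {f = f} f↗ {i} {j} i≤j with i Fin.≟ j
... | yes i≡j = ℕ.≤-reflexive (cong f i≡j)
... | no  i≢j = ℕ.<⇒≤ (f↗ (Fin.≤∧≢⇒< i≤j i≢j))

lookup-increasing : {xs : List ℕ} → AllPairs _<_ xs → Increasing (List.lookup xs)
lookup-increasing (x< ∷ xs↗) {zero}  {suc j} _         = All.lookup x< (∈-lookup j)
lookup-increasing (x< ∷ xs↗) {suc i} {suc j} (s≤s i<j) = lookup-increasing xs↗ i<j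

-- A strictly increasing list of length m is the image of the list of all
-- elements of Fin m.
increasing-enumeration : {m : ℕ} {xs : List ℕ} → AllPairs _<_ xs → length xs ≡ m →
  ∃ λ (f : Fin m → ℕ) → Increasing f × xs ≡ map f (allFin m)
increasing-enumeration {xs = xs} xs↗ ≡.refl = List.lookup xs , lookup-increasing xs↗ ,
  ≡.trans (≡.sym (List.tabulate-lookup xs)) (≡.sym (List.map-tabulate id (List.lookup xs)))

count-map-increasing : {m n : ℕ} {f g : Fin m → ℕ} → Increasing f → Increasing g →
  (j : Fin m) (is : Vec (Fin m) n) →
  count (ℕ._≤? f j) (Vec.map f is) ≡ count (ℕ._≤? g j) (Vec.map g is)
count-map-increasing f↗ g↗ j []       = ≡.refl
count-map-increasing {f = f} {g} f↗ g↗ j (i ∷ is) = cong₂ (λ b c → (if b then suc else id) c)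
  (does-⇔ (mk⇔ (increasing-preserves-≤ g↗ ∘ increasing-reflects-≤ f↗)
               (increasing-preserves-≤ f↗ ∘ increasing-reflects-≤ g↗)) (f i ℕ.≤? f j) (g i ℕ.≤? g j))
  (count-map-increasing f↗ g↗ j is)

-- The reduction of an array sees only the relative order of its entries.
red-map-increasing : {k m n : ℕ} {f g : Fin m → ℕ} → Increasing f → Increasing g →
  (F : Vec (Vec (Fin m) k) n) → red (Vec.map (Vec.map f) F) ≡ red (Vec.map (Vec.map g) F)
red-map-increasing {f = f} {g} f↗ g↗ F = begin
  red (Vec.map (Vec.map f) F)                    ≡⟨ red-map f ⟩
  Vec.map (Vec.map (λ j → count (ℕ._≤? f j) (Vec.map f (concat F)))) F
    ≡⟨ Vec.map-cong (Vec.map-cong (λ j → count-map-increasing f↗ g↗ j (concat F))) F ⟩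
  Vec.map (Vec.map (λ j → count (ℕ._≤? g j) (Vec.map g (concat F)))) F ≡⟨ red-map g ⟨
  red (Vec.map (Vec.map g) F)                    ∎
  where
  open ≡.≡-Reasoning
  red-map : ∀ h → red (Vec.map (Vec.map h) F) ≡
    Vec.map (Vec.map (λ j → count (ℕ._≤? h j) (Vec.map h (concat F)))) F
  red-map h = begin
    Vec.map (Vec.map ρ) (Vec.map (Vec.map h) F)   ≡⟨ Vec.map-∘ _ _ F ⟨
    Vec.map (Vec.map ρ ∘ Vec.map h) F             ≡⟨ Vec.map-cong (λ c → ≡.sym (Vec.map-∘ ρ h c)) F ⟩
    Vec.map (Vec.map (ρ ∘ h)) F
      ≡⟨ Vec.map-cong (Vec.map-cong (λ j → cong (count (ℕ._≤? h j)) (≡.sym (Vec.map-concat h F)))) F ⟩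
    Vec.map (Vec.map (λ j → count (ℕ._≤? h j) (Vec.map h (concat F)))) F ∎
    where
    ρ : ℕ → ℕ
    ρ v = count (ℕ._≤? v) (concat (Vec.map (Vec.map h) F))

-- Sums over lists in a commutative ring

module ListSum {c ℓ} (R : CommutativeRing c ℓ) where
  open CommutativeRing R
  open SemiringSum semiring
  private module +-Sg = CommutativeSemigroupProperties +-commutativeSemigroup
  open SemiringMult semiring using () renaming (_×_ to _×ᴺ_)
  open SetoidReasoning setoid

  -- The value of f summed over a list; repeated elements count repeatedly.
  ∑ : ∀ {a} {A : Set a} → List A → (A → Carrier) → Carrier
  ∑ xs f = foldr _+_ 0# (map f xs)

  module _ {A : Set} where
    ∑-cong : (xs : List A) {f g : A → Carrier} → (∀ x → f x ≈ g x) → ∑ xs f ≈ ∑ xs g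
    ∑-cong []       f≈g = refl
    ∑-cong (x ∷ xs) f≈g = +-cong (f≈g x) (∑-cong xs f≈g)

    ∑-cong-All : {xs : List A} {f g : A → Carrier} → All (λ x → f x ≈ g x) xs → ∑ xs f ≈ ∑ xs g
    ∑-cong-All []           = refl
    ∑-cong-All (eq ∷ eqs) = +-cong eq (∑-cong-All eqs)

    ∑-++ : (xs ys : List A) (f : A → Carrier) → ∑ (xs ++ ys) f ≈ ∑ xs f + ∑ ys f
    ∑-++ []       ys f = sym (+-identityˡ _)
    ∑-++ (x ∷ xs) ys f = trans (+-congˡ (∑-++ xs ys f)) (sym (+-assoc _ _ _))

    ∑-map : {B : Set} (g : B → A) (xs : List B) (f : A → Carrier) → ∑ (map g xs) f ≈ ∑ xs (f ∘ g)
    ∑-map g []       f = refl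
    ∑-map g (x ∷ xs) f = +-congˡ (∑-map g xs f)

    ∑-concatMap : {B : Set} (g : B → List A) (xs : List B) (f : A → Carrier) →
      ∑ (concatMap g xs) f ≈ ∑ xs (λ x → ∑ (g x) f)
    ∑-concatMap g []       f = refl
    ∑-concatMap g (x ∷ xs) f =
      trans (∑-++ (g x) (concatMap g xs) f) (+-congˡ (∑-concatMap g xs f))

    ∑-0 : (xs : List A) → ∑ xs (λ _ → 0#) ≈ 0#
    ∑-0 []       = refl
    ∑-0 (x ∷ xs) = trans (+-identityˡ _) (∑-0 xs)

    ∑-distrib-+ᴸ : (xs : List A) (f g : A → Carrier) →
      ∑ xs (λ x → f x + g x) ≈ ∑ xs f + ∑ xs g
    ∑-distrib-+ᴸ []       f g = sym (+-identityˡ _)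
    ∑-distrib-+ᴸ (x ∷ xs) f g = trans (+-congˡ (∑-distrib-+ᴸ xs f g)) (+-Sg.interchange _ _ _ _)

    *-distribˡ-∑ : (r : Carrier) (xs : List A) (f : A → Carrier) →
      r * ∑ xs f ≈ ∑ xs (λ x → r * f x)
    *-distribˡ-∑ r []       f = zeroʳ r
    *-distribˡ-∑ r (x ∷ xs) f = trans (distribˡ _ _ _) (+-congˡ (*-distribˡ-∑ r xs f))

    *-distribʳ-∑ : (r : Carrier) (xs : List A) (f : A → Carrier) →
      ∑ xs f * r ≈ ∑ xs (λ x → f x * r)
    *-distribʳ-∑ r xs f = trans (*-comm _ _)
      (trans (*-distribˡ-∑ r xs f) (∑-cong xs (λ x → *-comm r (f x))))

    ∑-const : (xs : List A) (r : Carrier) → ∑ xs (λ _ → r) ≈ (length xs ×ᴺ 1#) * r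
    ∑-const []       r = sym (zeroˡ r)
    ∑-const (x ∷ xs) r =
      trans (+-cong (sym (*-identityˡ r)) (∑-const xs r)) (sym (distribʳ r _ _))

    ∑-↭ : {xs ys : List A} (f : A → Carrier) → xs ↭ ys → ∑ xs f ≈ ∑ ys f
    ∑-↭ f ↭.refl            = refl
    ∑-↭ f (↭.prep x xs↭ys)    = +-congˡ (∑-↭ f xs↭ys)
    ∑-↭ f (↭.swap x y xs↭ys)  = trans (+-Sg.x∙yz≈y∙xz _ _ _) (+-congˡ (+-congˡ (∑-↭ f xs↭ys)))
    ∑-↭ f (↭.trans p q)       = trans (∑-↭ f p) (∑-↭ f q)

    ∑-exchange : (xs : List A) (n : ℕ) (f : A → Fin n → Carrier) →
      ∑ xs (λ x → ∑[ i < n ] f x i) ≈ ∑[ i < n ] ∑ xs (λ x → f x i)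
    ∑-exchange []       n f = sym (sum-replicate-zero n)
    ∑-exchange (x ∷ xs) n f = trans (+-congˡ (∑-exchange xs n f)) (sym (∑-distrib-+ {n} (f x) _))

  -- The Iverson bracket.
  indicator : Bool → Carrier
  indicator b = if b then 1# else 0#

  ∑-filter : {A : Set} {p : _} {P : Pred A p} (P? : Decidable P) (xs : List A) (f : A → Carrier) →
    ∑ (filter P? xs) f ≈ ∑ xs (λ x → indicator (does (P? x)) * f x)
  ∑-filter P? []       f = refl
  ∑-filter P? (x ∷ xs) f with does (P? x)
  ... | true  = +-cong (sym (*-identityˡ _)) (∑-filter P? xs f)
  ... | false = trans (∑-filter P? xs f) (sym (trans (+-congʳ (zeroˡ _)) (+-identityˡ _)))

  ∑-splits-suc : {A : Set} (a : ℕ) (x : A) (xs : List A) (f : Vec A (suc a) × List A → Carrier) →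
    ∑ (splits (suc a) (x ∷ xs)) f ≈
      ∑ (splits a xs) (f ∘ map₁ (x ∷_)) + ∑ (splits (suc a) xs) (f ∘ map₂ (x ∷_))
  ∑-splits-suc a x xs f = trans (∑-++ (map (map₁ (x ∷_)) (splits a xs)) _ f)
    (+-cong (∑-map _ (splits a xs) f) (∑-map _ (splits (suc a) xs) f))

  ∑-splits-short : {A : Set} {a : ℕ} (xs : List A) (f : Vec A a × List A → Carrier) →
    length xs < a → ∑ (splits a xs) f ≈ 0#
  ∑-splits-short {a = suc a} []       f _        = refl
  ∑-splits-short {a = suc a} (x ∷ xs) f (s≤s lt) = trans (∑-splits-suc a x xs f)
    (trans (+-cong (∑-splits-short xs _ lt) (∑-splits-short xs _ (ℕ.m<n⇒m<1+n lt))) (+-identityˡ 0#))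

  -- Choosing a entries and then b further ones amounts to choosing a + b entries
  -- and then a among these.  The function G receives the a entries, the b entries
  -- and the rest.
  ∑-splits-assoc : {A : Set} (a b : ℕ) (xs : List A) (G : Vec A a → List A → List A → Carrier) →
    ∑ (splits a xs) (λ p → ∑ (splits b (proj₂ p)) λ q → G (proj₁ p) (toList (proj₁ q)) (proj₂ q)) ≈
    ∑ (splits (a ℕ.+ b) xs) (λ p → ∑ (splits a (toList (proj₁ p))) λ q →
      G (proj₁ q) (proj₂ q) (proj₂ p))
  ∑-splits-assoc zero    b xs G = trans (+-identityʳ _)
    (∑-cong (splits b xs) (λ p → sym (+-identityʳ _)))
  ∑-splits-assoc (suc a) b []       G = refl
  ∑-splits-assoc {A} (suc a) b (x ∷ xs) G = begin
    ∑ (splits (suc a) (x ∷ xs)) (λ p → inner b (proj₁ p) (proj₂ p))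
      ≈⟨ ∑-splits-suc a x xs _ ⟩
    ∑ (splits a xs) (λ p → inner b (x ∷ proj₁ p) (proj₂ p)) + ∑ (splits (suc a) xs) (λ p → inner b (proj₁ p) (x ∷ proj₂ p))
      ≈⟨ +-cong (∑-splits-assoc a b xs (λ S → G (x ∷ S))) (rest b) ⟩
    T₁ + (∑ (splits (a ℕ.+ b) xs) (λ p → ∑ (splits (suc a) (toList (proj₁ p))) λ q → G (proj₁ q) (x ∷ proj₂ q) (proj₂ p)) + T₃ b)
      ≈⟨ +-assoc _ _ _ ⟨
    (T₁ + ∑ (splits (a ℕ.+ b) xs) (λ p → ∑ (splits (suc a) (toList (proj₁ p))) λ q → G (proj₁ q) (x ∷ proj₂ q) (proj₂ p))) + T₃ b
      ≈⟨ +-congʳ (∑-distrib-+ᴸ (splits (a ℕ.+ b) xs) _ _) ⟨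
    ∑ (splits (a ℕ.+ b) xs) (λ p → ∑ (splits a (toList (proj₁ p))) (λ q → G (x ∷ proj₁ q) (proj₂ q) (proj₂ p)) +
      ∑ (splits (suc a) (toList (proj₁ p))) (λ q → G (proj₁ q) (x ∷ proj₂ q) (proj₂ p))) + T₃ b
      ≈⟨ +-congʳ (∑-cong (splits (a ℕ.+ b) xs) (λ p → ∑-splits-suc a x (toList (proj₁ p)) _)) ⟨
    ∑ (splits (a ℕ.+ b) xs) (λ p → ∑ (splits (suc a) (x ∷ toList (proj₁ p))) λ q → G (proj₁ q) (proj₂ q) (proj₂ p)) + T₃ b
      ≈⟨ ∑-splits-suc (a ℕ.+ b) x xs _ ⟨
    ∑ (splits (suc a ℕ.+ b) (x ∷ xs)) (λ p → ∑ (splits (suc a) (toList (proj₁ p))) λ q → G (proj₁ q) (proj₂ q) (proj₂ p)) ∎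
    where
    inner : ℕ → Vec A (suc a) → List A → Carrier
    inner b S T = ∑ (splits b T) λ q → G S (toList (proj₁ q)) (proj₂ q)

    -- The parts of the right-hand side in which x is among the a entries (T₁),
    -- among the b entries (T₂), and among the rest (T₃).  The argument of T₂ is
    -- the number of entries other than x that are chosen.
    T₁ : Carrier
    T₁ = ∑ (splits (a ℕ.+ b) xs) (λ p → ∑ (splits a (toList (proj₁ p))) λ q → G (x ∷ proj₁ q) (proj₂ q) (proj₂ p))

    T₃ : ℕ → Carrier
    T₃ b = ∑ (splits (suc a ℕ.+ b) xs) (λ p → ∑ (splits (suc a) (toList (proj₁ p))) λ q → G (proj₁ q) (proj₂ q) (x ∷ proj₂ p))

    T₂ : (c : ℕ) → Carrier
    T₂ c = ∑ (splits c xs) (λ p → ∑ (splits (suc a) (toList (proj₁ p))) λ q → G (proj₁ q) (x ∷ proj₂ q) (proj₂ p))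

    -- The case where the first entry x is not among the a chosen ones: it is among
    -- the b next ones, which needs b positive, or it remains.
    rest : ∀ b → ∑ (splits (suc a) xs) (λ p → inner b (proj₁ p) (x ∷ proj₂ p)) ≈ T₂ (a ℕ.+ b) + T₃ b
    rest zero    = begin
      ∑ (splits (suc a) xs) (λ p → G (proj₁ p) [] (x ∷ proj₂ p) + 0#)
        ≈⟨ ∑-splits-assoc (suc a) 0 xs (λ S S′ T → G S S′ (x ∷ T)) ⟩
      T₃ 0             ≈⟨ +-identityˡ _ ⟨
      0# + T₃ 0        ≈⟨ +-congʳ (∑-0 (splits (a ℕ.+ 0) xs)) ⟨
      ∑ (splits (a ℕ.+ 0) xs) (λ _ → 0#) + T₃ 0
        ≈⟨ +-congʳ (∑-cong (splits (a ℕ.+ 0) xs) (λ p → ∑-splits-short (toList (proj₁ p)) _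
             (ℕ.≤-reflexive (cong suc (≡.trans (Vec.length-toList (proj₁ p)) (ℕ.+-identityʳ a)))))) ⟨
      T₂ (a ℕ.+ 0) + T₃ 0 ∎
    rest (suc b) = begin
      ∑ (splits (suc a) xs) (λ p → inner (suc b) (proj₁ p) (x ∷ proj₂ p))
        ≈⟨ ∑-cong (splits (suc a) xs) (λ p → ∑-splits-suc b x (proj₂ p) _) ⟩
      ∑ (splits (suc a) xs) (λ p → ∑ (splits b (proj₂ p)) (λ q → G (proj₁ p) (x ∷ toList (proj₁ q)) (proj₂ q)) +
        ∑ (splits (suc b) (proj₂ p)) (λ q → G (proj₁ p) (toList (proj₁ q)) (x ∷ proj₂ q)))
        ≈⟨ ∑-distrib-+ᴸ (splits (suc a) xs) _ _ ⟩
      ∑ (splits (suc a) xs) (λ p → ∑ (splits b (proj₂ p)) (λ q → G (proj₁ p) (x ∷ toList (proj₁ q)) (proj₂ q))) +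
      ∑ (splits (suc a) xs) (λ p → ∑ (splits (suc b) (proj₂ p)) (λ q → G (proj₁ p) (toList (proj₁ q)) (x ∷ proj₂ q)))
        ≈⟨ +-cong (∑-splits-assoc (suc a) b xs (λ S S′ → G S (x ∷ S′)))
                  (∑-splits-assoc (suc a) (suc b) xs (λ S S′ T → G S S′ (x ∷ T))) ⟩
      T₂ (suc a ℕ.+ b) + T₃ (suc b)
        ≡⟨ cong (λ c → T₂ c + T₃ (suc b)) (ℕ.+-suc a b) ⟨
      T₂ (a ℕ.+ suc b) + T₃ (suc b) ∎

  ∑-arrangements-suc : {A : Set} (k n : ℕ) (xs : List A) (h : Vec (Vec A k) (suc n) → Carrier) →
    ∑ (arrangements k (suc n) xs) h ≈
      ∑ (splits k xs) (λ p → ∑ (arrangements k n (proj₂ p)) (λ F → h (proj₁ p ∷ F)))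
  ∑-arrangements-suc k n xs h = trans (∑-concatMap _ (splits k xs) h)
    (∑-cong (splits k xs) (λ p → ∑-map _ (arrangements k n (proj₂ p)) h))

  -- An arrangement of p + q columns is a choice of the entries of the first p columns
  -- with an arrangement of each of the two parts.
  ∑-arrangements-+ : {A : Set} (k p q : ℕ) (xs : List A) (h : Vec (Vec A k) (p ℕ.+ q) → Carrier) →
    ∑ (arrangements k (p ℕ.+ q) xs) h ≈
      ∑ (splits (p ℕ.* k) xs) (λ s → ∑ (arrangements k p (toList (proj₁ s))) λ F →
        ∑ (arrangements k q (proj₂ s)) λ G → h (F Vec.++ G))
  ∑-arrangements-+ k zero    q xs h = sym (trans (+-identityʳ _) (+-identityʳ _))
  ∑-arrangements-+ k (suc p) q xs h = begin
    ∑ (arrangements k (suc p ℕ.+ q) xs) h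
      ≈⟨ ∑-arrangements-suc k (p ℕ.+ q) xs h ⟩
    ∑ (splits k xs) (λ s → ∑ (arrangements k (p ℕ.+ q) (proj₂ s)) (λ F → h (proj₁ s ∷ F)))
      ≈⟨ ∑-cong (splits k xs) (λ s → ∑-arrangements-+ k p q (proj₂ s) _) ⟩
    ∑ (splits k xs) (λ s → ∑ (splits (p ℕ.* k) (proj₂ s)) λ t → H (proj₁ s) (toList (proj₁ t)) (proj₂ t))
      ≈⟨ ∑-splits-assoc k (p ℕ.* k) xs H ⟩
    ∑ (splits (suc p ℕ.* k) xs) (λ s → ∑ (splits k (toList (proj₁ s))) λ t → H (proj₁ t) (proj₂ t) (proj₂ s))
      ≈⟨ ∑-cong (splits (suc p ℕ.* k) xs) (λ s → ∑-arrangements-suc k p (toList (proj₁ s)) _) ⟨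
    _ ∎
    where
    H : Vec _ k → List _ → List _ → Carrier
    H c S T = ∑ (arrangements k p S) λ F → ∑ (arrangements k q T) λ G → h (c ∷ (F Vec.++ G))

  -- Functions of an array that depend only on the relative order of its entries:
  -- relabelling an array over Fin m by two increasing functions gives the same value.
  OrderInvariant : {k n : ℕ} → (Array k n → Carrier) → Set ℓ
  OrderInvariant {k} {n} h = ∀ {m} {f g : Fin m → ℕ} → Increasing f → Increasing g →
    (F : Vec (Vec (Fin m) k) n) → h (Vec.map (Vec.map f) F) ≈ h (Vec.map (Vec.map g) F)

  -- The sum of an order-invariant function over arrangements depends only on the
  -- number of available entries.
  ∑-arrangements-invariant : {k n : ℕ} {h : Array k n → Carrier} → OrderInvariant h →
    {xs ys : List ℕ} → AllPairs _<_ xs → AllPairs _<_ ys → length xs ≡ length ys →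
    ∑ (arrangements k n xs) h ≈ ∑ (arrangements k n ys) h
  ∑-arrangements-invariant {k} {n} {h} inv xs↗ ys↗ eq
    with increasing-enumeration xs↗ eq | increasing-enumeration ys↗ ≡.refl
  ... | f , f↗ , xs≡ | g , g↗ , ys≡ = begin
    ∑ (arrangements k n _) h                           ≡⟨ cong (λ zs → ∑ (arrangements k n zs) h) xs≡ ⟩
    ∑ (arrangements k n (map f is)) h                  ≈⟨ pull f ⟩
    ∑ (arrangements k n is) (h ∘ Vec.map (Vec.map f))  ≈⟨ ∑-cong (arrangements k n is) (inv f↗ g↗) ⟩
    ∑ (arrangements k n is) (h ∘ Vec.map (Vec.map g))  ≈⟨ pull g ⟨
    ∑ (arrangements k n (map g is)) h                  ≡⟨ cong (λ zs → ∑ (arrangements k n zs) h) ys≡ ⟨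
    ∑ (arrangements k n _) h                           ∎
    where
    is : List (Fin _)
    is = allFin _

    pull : ∀ e → ∑ (arrangements k n (map e is)) h ≈ ∑ (arrangements k n is) (h ∘ Vec.map (Vec.map e))
    pull e = trans (reflexive (cong (λ Fs → ∑ Fs h) (arrangements-map e k n is)))
      (∑-map (Vec.map (Vec.map e)) (arrangements k n is) h)
-- Matches of an array and of its tails

module _ {ℓ} {k : ℕ} (Υ : Pred (Array k 2) ℓ) where

  S-first : ∀ {n} (c d : Vec ℕ k) (F : Array k n) →
    S Υ (c ∷ d ∷ F) 1 ⇔ Υ (red (c ∷ d ∷ []))
  S-first c d F = mk⇔ (λ { (zero , _ , m) → m }) (λ m → zero , ≡.refl , m)

  S-shift : ∀ {n} (c : Vec ℕ k) (F : Array k n) (j : ℕ) →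
    S Υ (c ∷ F) (suc (suc j)) ⇔ S Υ F (suc j)
  S-shift c []      j = mk⇔ (λ ()) (λ ())
  S-shift c (d ∷ F) j = mk⇔
    (λ { (suc i , eq , m) → i , ℕ.suc-injective eq , m })
    (λ { (i , eq , m) → suc i , cong suc eq , m })

  S-shift² : ∀ {n} (c d : Vec ℕ k) (F : Array k n) (j : ℕ) →
    S Υ (c ∷ d ∷ F) (suc (suc (suc j))) ⇔ S Υ F (suc j)
  S-shift² c d F j = mk⇔ (to (S-shift d F j) ∘ to (S-shift c (d ∷ F) (suc j)))
    (from (S-shift c (d ∷ F) (suc j)) ∘ from (S-shift d F j))
    where open Equivalence

  matchesEverywhere-∷ : ∀ {n} (c d : Vec ℕ k) (F : Array k n) →
    MatchesEverywhere Υ (c ∷ d ∷ F) ⇔ (Υ (red (c ∷ d ∷ [])) × MatchesEverywhere Υ (d ∷ F))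
  matchesEverywhere-∷ c d F = mk⇔ (λ m → m zero , m ∘ suc)
    (λ { (m , ms) zero → m ; (m , ms) (suc i) → ms i })

  matchesAtOdd-∷ : ∀ {n} (c d : Vec ℕ k) (F : Array k n) →
    MatchesAtOdd Υ (c ∷ d ∷ F) ⇔ (Υ (red (c ∷ d ∷ [])) × MatchesAtOdd Υ F)
  matchesAtOdd-∷ c d F = mk⇔
    (λ m → to (S-first c d F) (m zero 2∤1) ,
      λ i odd → to (S-shift² c d F (toℕ i)) (m (suc (suc i)) (odd ∘ λ 2∣ → ∣m+n∣m⇒∣n 2∣ ∣-refl)))
    (λ { (m , ms) zero          odd → from (S-first c d F) m
       ; (m , ms) (suc zero)    odd → contradiction ∣-refl odd
       ; (m , ms) (suc (suc i)) odd → from (S-shift² c d F (toℕ i)) (ms i (odd ∘ ∣m∣n⇒∣m+n ∣-refl)) })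
    where
    open Equivalence
    2∤1 : ¬ (2 ∣ 1)
    2∤1 2∣1 with ∣1⇒≡1 2∣1
    ... | ()

  -- Position 1 of a single column is odd and cannot carry a match.
  ¬matchesAtOdd-[-] : (c : Vec ℕ k) → ¬ MatchesAtOdd Υ (c ∷ [])
  ¬matchesAtOdd-[-] c m with m zero (λ 2∣1 → contradiction (∣1⇒≡1 2∣1) λ ())
  ... | ()

length-filter-∷ : ∀ {a p} {A : Set a} {P : Pred A p} (P? : Decidable P) (x : A) (xs : List A) →
  length (filter P? (x ∷ xs)) ≡ (if does (P? x) then 1 else 0) ℕ.+ length (filter P? xs)
length-filter-∷ P? x xs with does (P? x)
... | true  = ≡.refl
... | false = ≡.refl

length-filter-applyUpTo : ∀ {p q} {P : Pred ℕ p} {Q : Pred ℕ q} (P? : Decidable P) (Q? : Decidable Q)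
  (f g : ℕ → ℕ) → (∀ i → does (P? (f i)) ≡ does (Q? (g i))) → ∀ n →
  length (filter P? (applyUpTo f n)) ≡ length (filter Q? (applyUpTo g n))
length-filter-applyUpTo P? Q? f g P≡Q zero    = ≡.refl
length-filter-applyUpTo P? Q? f g P≡Q (suc n) = ≡.trans (length-filter-∷ P? (f 0) _)
  (≡.trans (cong₂ (λ b m → (if b then 1 else 0) ℕ.+ m) (P≡Q 0)
     (length-filter-applyUpTo P? Q? (f ∘ suc) (g ∘ suc) (P≡Q ∘ suc) n))
   (≡.sym (length-filter-∷ Q? (g 0) _)))

module _ {ℓ} {k : ℕ} {Υ : Pred (Array k 2) ℓ} (Υ? : Decidable Υ) where

  -- The number of matches at the positions 2, 4, ..., 2N.
  evenMatches : ∀ {n} → ℕ → Array k n → ℕ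
  evenMatches N F = length (filter (λ i → S? Υ? F (2 ℕ.* i)) [1⋯ N ])

  evenMatches-[] : ∀ N → evenMatches N [] ≡ 0
  evenMatches-[] N = ≡.trans
    (length-filter-applyUpTo (λ i → S? Υ? [] (2 ℕ.* i)) (λ _ → no λ ()) suc suc
      (λ i → dec-false (S? Υ? [] (2 ℕ.* suc i)) (λ ())) N)
    (none (applyUpTo suc N))
    where
    none : ∀ xs → length (filter {A = ℕ} {P = λ _ → ⊥} (λ _ → no λ ()) xs) ≡ 0
    none []       = ≡.refl
    none (_ ∷ xs) = none xs

  -- The first even position compares the second column of the array with the third;
  -- the others are the even positions of the array without its first two columns.
  evenMatches-∷ : ∀ {n} N (c d : Vec ℕ k) (F : Array k n) →
    evenMatches (suc N) (c ∷ d ∷ F) ≡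
      (if does (S? Υ? (d ∷ F) 1) then 1 else 0) ℕ.+ evenMatches N F
  evenMatches-∷ N c d F = ≡.trans (length-filter-∷ (λ i → S? Υ? (c ∷ d ∷ F) (2 ℕ.* i)) 1 _)
    (cong₂ (λ b m → (if b then 1 else 0) ℕ.+ m)
      (does-⇔ (S-shift Υ c (d ∷ F) 0) (S? Υ? (c ∷ d ∷ F) 2) (S? Υ? (d ∷ F) 1))
      (length-filter-applyUpTo _ (λ i → S? Υ? F (2 ℕ.* i)) (λ i → suc (suc i)) suc
        (λ i → ≡.trans (cong (does ∘ S? Υ? (c ∷ d ∷ F)) (ℕ.*-suc 2 (suc i)))
          (does-⇔ (S-shift² Υ c d F _) (S? Υ? (c ∷ d ∷ F) (2 ℕ.+ 2 ℕ.* suc i)) (S? Υ? F (2 ℕ.* suc i)))) N))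

-- Weights of sequences of columns

module Weights {c ℓ} (R : CommutativeRing c ℓ) where
  open CommutativeRing R
  open ListSum R
  open SemiringSum semiring
  open SemiringExp semiring
  open SemiringMult semiring using () renaming (_×_ to _×ᴺ_)
  open CommutativeSemigroupProperties *-commutativeSemigroup using (x∙yz≈y∙xz)
  open SetoidReasoning setoid
  open SemiringSolver commutativeSemiring
    using (solve; _:=_; _:+_; _:*_; con)

  indicator-∧ : ∀ a b → indicator (a ∧ b) ≈ indicator a * indicator b
  indicator-∧ true  b = sym (*-identityˡ _)
  indicator-∧ false b = sym (zeroˡ _)

  module _ {a} {A : Set a} (μ : A → A → Carrier) where
    -- The weight of a sequence in which all neighbours must match.  In the
    -- application A is the type of columns and μ is the indicator of a match.
    chainWeight : List A → Carrier
    chainWeight []           = 1#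
    chainWeight (c ∷ [])     = 1#
    chainWeight (c ∷ d ∷ cs) = μ c d * chainWeight (d ∷ cs)

    module _ (y : Carrier) where
      -- The weight of a sequence cut into consecutive pairs: both members of a
      -- pair must match, and two neighbouring pairs contribute the factor
      -- 1 + μ y.  A sequence of odd length has weight 0.  The value of
      -- joinedWeight d is that of the part after d, when d ends a pair, with the
      -- factor that joins it to d.
      pairedWeight : List A → Carrier
      joinedWeight : A → List A → Carrier

      pairedWeight []           = 1#
      pairedWeight (c ∷ [])     = 0#
      pairedWeight (c ∷ d ∷ cs) = μ c d * joinedWeight d cs

      joinedWeight d []       = 1#
      joinedWeight d (c ∷ cs) = (1# + μ d c * y) * pairedWeight (c ∷ cs)

      -- Expansion according to the first gap between pairs at which the term 1 of
      -- 1 + μ y is chosen; this gap follows the pair number i + 1.  The summand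
      -- i = n is the case where there is no such gap.
      pairedWeight-cut : ∀ n cs → length cs ≡ 2 ℕ.* suc n → pairedWeight cs ≈
        ∑[ i ≤ n ] (y ^ toℕ i * (chainWeight (take (2 ℕ.* suc (toℕ i)) cs) * pairedWeight (drop (2 ℕ.* suc (toℕ i)) cs)))
      pairedWeight-cut n cs len = go n cs (≡.trans len (ℕ.*-suc 2 n))
        where
        term : List A → ℕ → ℕ → Carrier
        term cs i l = y ^ i * (chainWeight (take l cs) * pairedWeight (drop l cs))

        go : ∀ n cs → length cs ≡ 2 ℕ.+ 2 ℕ.* n → pairedWeight cs ≈
          ∑[ i ≤ n ] (term cs (toℕ i) (2 ℕ.* suc (toℕ i)))
        go zero    (c ∷ d ∷ [])     len =
          solve 1 (λ m → m :* con 1 := con 1 :* ((m :* con 1) :* con 1) :+ con 0) refl (μ c d)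
        go (suc n) (c ∷ d ∷ [])     ()
        go (suc n) (c ∷ d ∷ c′ ∷ cs) len = begin
          μ c d * ((1# + μ d c′ * y) * pairedWeight F)
            ≈⟨ solve 4 (λ m m′ y v → m :* ((con 1 :+ m′ :* y) :* v) :=
                 con 1 :* ((m :* con 1) :* v) :+ (y :* m :* m′) :* v) refl (μ c d) (μ d c′) y (pairedWeight F) ⟩
          1# * ((μ c d * 1#) * pairedWeight F) + (y * μ c d * μ d c′) * pairedWeight F
            ≈⟨ +-congˡ (*-congˡ (go n F (≡.trans (ℕ.suc-injective (ℕ.suc-injective len)) (ℕ.*-suc 2 n)))) ⟩
          1# * ((μ c d * 1#) * pairedWeight F) + (y * μ c d * μ d c′) * ∑[ i ≤ n ] (term F (toℕ i) (2 ℕ.* suc (toℕ i)))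
            ≈⟨ +-congˡ (*-distribˡ-sum {suc n} _ (λ i → term F (toℕ i) (2 ℕ.* suc (toℕ i)))) ⟩
          1# * ((μ c d * 1#) * pairedWeight F) + ∑[ i ≤ n ] ((y * μ c d * μ d c′) * term F (toℕ i) (2 ℕ.* suc (toℕ i)))
            ≈⟨ +-congˡ (sum-cong-≋ {suc n} (λ i → step (toℕ i))) ⟩
          1# * ((μ c d * 1#) * pairedWeight F) + ∑[ i ≤ n ] (term (c ∷ d ∷ F) (suc (toℕ i)) (2 ℕ.* suc (suc (toℕ i)))) ∎
          where
          F : List A
          F = c′ ∷ cs

          step : ∀ i → (y * μ c d * μ d c′) * term F i (2 ℕ.* suc i) ≈
            term (c ∷ d ∷ F) (suc i) (2 ℕ.* suc (suc i))
          step i = trans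
            (solve 6 (λ y m m′ z e v → (y :* m :* m′) :* (z :* (e :* v)) :=
               (y :* z) :* ((m :* (m′ :* e)) :* v)) refl y (μ c d) (μ d c′) (y ^ i)
                 (chainWeight (take (2 ℕ.* suc i) F)) (pairedWeight (drop (2 ℕ.* suc i) F)))
            (reflexive (cong (term (c ∷ d ∷ F) (suc i)) (≡.sym (ℕ.*-suc 2 (suc i)))))

  module _ {a b} {A : Set a} {B : Set b} {μ : A → A → Carrier} {ν : B → B → Carrier}
    {T : Set} (f : T → A) (g : T → B) (μ≡ν : ∀ s t → μ (f s) (f t) ≡ ν (g s) (g t)) where

    chainWeight-map : ∀ ts → chainWeight μ (List.map f ts) ≡ chainWeight ν (List.map g ts)
    chainWeight-map []           = ≡.refl
    chainWeight-map (s ∷ [])     = ≡.refl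
    chainWeight-map (s ∷ t ∷ ts) = cong₂ _*_ (μ≡ν s t) (chainWeight-map (t ∷ ts))

    pairedWeight-map : ∀ y ts → pairedWeight μ y (List.map f ts) ≡ pairedWeight ν y (List.map g ts)
    pairedWeight-map y []               = ≡.refl
    pairedWeight-map y (s ∷ [])         = ≡.refl
    pairedWeight-map y (s ∷ t ∷ [])     = cong (_* 1#) (μ≡ν s t)
    pairedWeight-map y (s ∷ t ∷ u ∷ ts) = cong₂ _*_ (μ≡ν s t)
      (cong₂ (λ m v → (1# + m * y) * v) (μ≡ν t u) (pairedWeight-map y (u ∷ ts)))

  module _ {ℓ′} {k : ℕ} {Υ : Pred (Array k 2) ℓ′} (Υ? : Decidable Υ) where

    -- The indicator of a match formed by two neighbouring columns.
    match : Vec ℕ k → Vec ℕ k → Carrier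
    match c d = indicator (does (Υ? (red (c ∷ d ∷ []))))

    match-invariant : ∀ {m} {f g : Fin m → ℕ} → Increasing f → Increasing g → ∀ s t →
      match (Vec.map f s) (Vec.map f t) ≡ match (Vec.map g s) (Vec.map g t)
    match-invariant f↗ g↗ s t =
      cong (indicator ∘ does ∘ Υ?) (red-map-increasing f↗ g↗ (s ∷ t ∷ []))

    chainWeight-invariant : ∀ {n} → OrderInvariant {k} {n} (chainWeight match ∘ toList)
    chainWeight-invariant {f = f} {g} f↗ g↗ F = reflexive
      (≡.trans (cong (chainWeight match) (Vec.toList-map (Vec.map f) F)) (≡.trans
        (chainWeight-map _ _ (match-invariant f↗ g↗) (toList F))
        (cong (chainWeight match) (≡.sym (Vec.toList-map (Vec.map g) F)))))

    pairedWeight-invariant : ∀ {n} y → OrderInvariant {k} {n} (pairedWeight match y ∘ toList)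
    pairedWeight-invariant y {f = f} {g} f↗ g↗ F = reflexive
      (≡.trans (cong (pairedWeight match y) (Vec.toList-map (Vec.map f) F)) (≡.trans
        (pairedWeight-map _ _ (match-invariant f↗ g↗) y (toList F))
        (cong (pairedWeight match y) (≡.sym (Vec.toList-map (Vec.map g) F)))))

    indicator-matchesEverywhere : ∀ {n} (F : Array k n) →
      indicator (does (matchesEverywhere? Υ? F)) ≈ chainWeight match (toList F)
    indicator-matchesEverywhere []          = refl
    indicator-matchesEverywhere (c ∷ [])    = refl
    indicator-matchesEverywhere (c ∷ d ∷ F) = begin
      indicator (does (matchesEverywhere? Υ? (c ∷ d ∷ F)))
        ≡⟨ cong indicator (does-⇔ (matchesEverywhere-∷ Υ c d F) (matchesEverywhere? Υ? (c ∷ d ∷ F))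
             (Υ? (red (c ∷ d ∷ [])) ×-dec matchesEverywhere? Υ? (d ∷ F))) ⟩
      indicator (does (Υ? (red (c ∷ d ∷ []))) ∧ does (matchesEverywhere? Υ? (d ∷ F)))
        ≈⟨ indicator-∧ (does (Υ? (red (c ∷ d ∷ [])))) _ ⟩
      match c d * indicator (does (matchesEverywhere? Υ? (d ∷ F)))
        ≈⟨ *-congˡ (indicator-matchesEverywhere (d ∷ F)) ⟩
      match c d * chainWeight match (toList (d ∷ F)) ∎

    module _ {x y : Carrier} (1+y≈x : 1# + y ≈ x) where

      power-indicator : ∀ b → x ^ (if b then 1 else 0) ≈ 1# + indicator b * y
      power-indicator true  = trans (*-identityʳ x) (trans (sym 1+y≈x) (+-congˡ (sym (*-identityˡ y))))
      power-indicator false = sym (trans (+-congˡ (zeroˡ y)) (+-identityʳ 1#))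

      -- Counting up to any N that is at least n counts all even positions, since
      -- no match starts at the last column or beyond.
      indicator-matchesAtOdd-power : ∀ {n} (F : Array k n) N → n ≤ N →
        indicator (does (matchesAtOdd? Υ? F)) * x ^ evenMatches Υ? N F ≈ pairedWeight match y (toList F)
      indicator-matchesAtOdd-power []       N _ =
        trans (*-identityˡ _) (^-congʳ x (evenMatches-[] Υ? N))
      indicator-matchesAtOdd-power (c ∷ []) N _ = trans
        (*-congʳ (reflexive (cong indicator (dec-false (matchesAtOdd? Υ? (c ∷ [])) (¬matchesAtOdd-[-] Υ c)))))
        (zeroˡ _)
      indicator-matchesAtOdd-power (c ∷ d ∷ F) (suc N) (s≤s n<N) = begin
        indicator (does (matchesAtOdd? Υ? (c ∷ d ∷ F))) * x ^ evenMatches Υ? (suc N) (c ∷ d ∷ F)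
          ≈⟨ *-cong
               (trans (reflexive (cong indicator (does-⇔ (matchesAtOdd-∷ Υ c d F)
                   (matchesAtOdd? Υ? (c ∷ d ∷ F)) (Υ? (red (c ∷ d ∷ [])) ×-dec matchesAtOdd? Υ? F))))
                 (indicator-∧ (does (Υ? (red (c ∷ d ∷ [])))) _))
               (trans (^-congʳ x (evenMatches-∷ Υ? N c d F))
                 (^-homo-* x (if does (S? Υ? (d ∷ F) 1) then 1 else 0) (evenMatches Υ? N F))) ⟩
        (match c d * indicator (does (matchesAtOdd? Υ? F))) *
          (x ^ (if does (S? Υ? (d ∷ F) 1) then 1 else 0) * x ^ evenMatches Υ? N F)
          ≈⟨ solve 4 (λ m o b p → (m :* o) :* (b :* p) := m :* (b :* (o :* p))) refl _ _ _ _ ⟩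
        match c d * (x ^ (if does (S? Υ? (d ∷ F) 1) then 1 else 0) *
          (indicator (does (matchesAtOdd? Υ? F)) * x ^ evenMatches Υ? N F))
          ≈⟨ *-congˡ (*-cong (power-indicator _)
               (indicator-matchesAtOdd-power F N (ℕ.<⇒≤ n<N))) ⟩
        match c d * ((1# + indicator (does (S? Υ? (d ∷ F) 1)) * y) * pairedWeight match y (toList F))
          ≈⟨ *-congˡ (join F) ⟩
        match c d * joinedWeight match y d (toList F) ∎
        where
        join : ∀ {n} (F : Array k n) →
          (1# + indicator (does (S? Υ? (d ∷ F) 1)) * y) * pairedWeight match y (toList F) ≈
            joinedWeight match y d (toList F)
        join []       = trans (*-identityʳ _) (trans
          (+-congˡ (trans (*-congʳ (reflexive (cong indicator (dec-false (S? Υ? (d ∷ []) 1) (λ ()))))) (zeroˡ y)))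
          (+-identityʳ 1#))
        join (c′ ∷ F) = *-congʳ (+-congˡ (*-congʳ (reflexive (cong indicator
          (does-⇔ (S-first Υ d c′ F) (S? Υ? (d ∷ c′ ∷ F) 1) (Υ? (red (d ∷ c′ ∷ []))))))))
-- Power series in the square of the variable

module EvenSeries {c ℓ} (R : CommutativeRing c ℓ) where
  private
    module P where
      open PowerSeries R public
      open CommutativeRing commutativeRing public hiding (_≈_; _+_; -_; isCommutativeRing)
  open CommutativeRing R
  open P using (∑≥0-t²ⁿ; ∑≥1-t²ⁿ; _⊛_)
  open SemiringSum semiring

  ∑≥0-t²ⁿ-cong : ∀ {a b} → a P.≈ b → ∑≥0-t²ⁿ a P.≈ ∑≥0-t²ⁿ b
  ∑≥0-t²ⁿ-cong a≈b zero          = a≈b 0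
  ∑≥0-t²ⁿ-cong a≈b (suc zero)    = refl
  ∑≥0-t²ⁿ-cong a≈b (suc (suc m)) = ∑≥0-t²ⁿ-cong (a≈b ∘ suc) m

  ∑≥0-t²ⁿ-+ : ∀ a b → ∑≥0-t²ⁿ (λ n → a n + b n) P.≈ (∑≥0-t²ⁿ a P.+ ∑≥0-t²ⁿ b)
  ∑≥0-t²ⁿ-+ a b zero          = refl
  ∑≥0-t²ⁿ-+ a b (suc zero)    = sym (+-identityˡ 0#)
  ∑≥0-t²ⁿ-+ a b (suc (suc m)) = ∑≥0-t²ⁿ-+ (a ∘ suc) (b ∘ suc) m

  ∑≥0-t²ⁿ-scale : ∀ r a m → ∑≥0-t²ⁿ (λ n → r * a n) m ≈ r * ∑≥0-t²ⁿ a m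
  ∑≥0-t²ⁿ-scale r a zero          = refl
  ∑≥0-t²ⁿ-scale r a (suc zero)    = sym (zeroʳ r)
  ∑≥0-t²ⁿ-scale r a (suc (suc m)) = ∑≥0-t²ⁿ-scale r (a ∘ suc) m

  -- The substitution of t² for the variable is multiplicative.
  ∑≥0-t²ⁿ-⊛ : ∀ a b → (∑≥0-t²ⁿ a ⊛ ∑≥0-t²ⁿ b) P.≈ ∑≥0-t²ⁿ (a ⊛ b)
  ∑≥0-t²ⁿ-⊛ a b zero          = refl
  ∑≥0-t²ⁿ-⊛ a b (suc zero)    =
    trans (+-cong (zeroʳ _) (trans (+-congʳ (zeroˡ _)) (+-identityˡ 0#))) (+-identityˡ 0#)
  ∑≥0-t²ⁿ-⊛ a b (suc (suc m)) = begin
    a 0 * ∑≥0-t²ⁿ (b ∘ suc) m + (0# * ∑≥0-t²ⁿ b (suc m) + (∑≥0-t²ⁿ (a ∘ suc) ⊛ ∑≥0-t²ⁿ b) m)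
      ≈⟨ +-cong (sym (∑≥0-t²ⁿ-scale (a 0) (b ∘ suc) m))
                (trans (+-congʳ (zeroˡ _)) (trans (+-identityˡ _) (∑≥0-t²ⁿ-⊛ (a ∘ suc) b m))) ⟩
    ∑≥0-t²ⁿ (λ n → a 0 * b (suc n)) m + ∑≥0-t²ⁿ ((a ∘ suc) ⊛ b) m
      ≈⟨ ∑≥0-t²ⁿ-+ (λ n → a 0 * b (suc n)) ((a ∘ suc) ⊛ b) m ⟨
    ∑≥0-t²ⁿ (λ n → a 0 * b (suc n) + ((a ∘ suc) ⊛ b) n) m ∎
    where open SetoidReasoning setoid

  ∑≥1-t²ⁿ-unfold : ∀ a b → b 0 ≈ 0# → (∀ n → b (suc n) ≈ a (suc n)) → ∑≥1-t²ⁿ a P.≈ ∑≥0-t²ⁿ b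
  ∑≥1-t²ⁿ-unfold a b b₀ bₛ = ∑≥0-t²ⁿ-cong λ { zero → sym b₀ ; (suc n) → sym (bₛ n) }

  1+∑≥1-t²ⁿ : ∀ a → a 0 ≈ 1# → (P.1# P.+ ∑≥1-t²ⁿ a) P.≈ ∑≥0-t²ⁿ a
  1+∑≥1-t²ⁿ a a₀ zero          = trans (+-identityʳ 1#) (sym a₀)
  1+∑≥1-t²ⁿ a a₀ (suc zero)    = +-identityˡ 0#
  1+∑≥1-t²ⁿ a a₀ (suc (suc m)) = +-identityˡ _

  -- A sequence a with a convolution recurrence driven by b has as its generating
  -- function the reciprocal of 1 minus that of b.
  1+∑≥1-t²ⁿ-reciprocal : ∀ a b → a 0 ≈ 1# →
    (∀ n → a (suc n) ≈ ∑[ i ≤ n ] (b (suc (toℕ i)) * a (n ∸ toℕ i))) →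
    (P.1# P.+ ∑≥1-t²ⁿ a) P.≈ P.1/ (P.1# P.- ∑≥1-t²ⁿ b)
  1+∑≥1-t²ⁿ-reciprocal a b a₀ rec = begin
    A                            ≈⟨ P.*-identityʳ A ⟨
    A ⊛ P.1#                     ≈⟨ P.*-congˡ {A} (P.1/-inverseʳ (P.1# P.- B) head≈1) ⟨
    A ⊛ ((P.1# P.- B) ⊛ V)       ≈⟨ P.*-assoc A (P.1# P.- B) V ⟨
    (A ⊛ (P.1# P.- B)) ⊛ V       ≈⟨ P.*-congʳ {V} A[1-B]≈1 ⟩
    P.1# ⊛ V                     ≈⟨ P.*-identityˡ V ⟩
    V                            ∎
    where
    open SetoidReasoning P.setoid
    open RingProperties (CommutativeRing.ring P.commutativeRing)
      using (-‿distribʳ-*)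

    A B V : P.Series
    A = P.1# P.+ ∑≥1-t²ⁿ a
    B = ∑≥1-t²ⁿ b
    V = P.1/ (P.1# P.- B)

    head≈1 : 1# + - 0# ≈ 1#
    head≈1 = trans (+-congˡ (trans (sym (+-identityˡ _)) (-‿inverseʳ 0#))) (+-identityʳ 1#)

    -- The sequence b with its irrelevant value at 0 replaced by 0.
    b′ : P.Series
    b′ zero    = 0#
    b′ (suc n) = b (suc n)

    BA : (B ⊛ A) P.≈ ∑≥1-t²ⁿ a
    BA = begin
      B ⊛ A                      ≈⟨ P.*-cong {B} {∑≥0-t²ⁿ b′} (∑≥1-t²ⁿ-unfold b b′ refl (λ _ → refl)) (1+∑≥1-t²ⁿ a a₀) ⟩
      ∑≥0-t²ⁿ b′ ⊛ ∑≥0-t²ⁿ a     ≈⟨ ∑≥0-t²ⁿ-⊛ b′ a ⟩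
      ∑≥0-t²ⁿ (b′ ⊛ a)           ≈⟨ ∑≥1-t²ⁿ-unfold a (b′ ⊛ a)
                                      (trans (+-identityʳ _) (zeroˡ _))
                                      (λ n → trans (+-congʳ (zeroˡ _)) (trans (+-identityˡ _) (sym (rec n)))) ⟨
      ∑≥1-t²ⁿ a                  ∎

    A[1-B]≈1 : (A ⊛ (P.1# P.- B)) P.≈ P.1#
    A[1-B]≈1 = begin
      A ⊛ (P.1# P.- B)              ≈⟨ P.distribˡ A P.1# (P.- B) ⟩
      (A ⊛ P.1#) P.+ (A ⊛ (P.- B))  ≈⟨ P.+-cong {A ⊛ P.1#} (P.*-identityʳ A) (P.sym (-‿distribʳ-* A B)) ⟩
      A P.+ (P.- (A ⊛ B))           ≈⟨ P.+-congˡ {A} (P.-‿cong (P.trans (P.*-comm A B) BA)) ⟩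
      (P.1# P.+ A₁) P.+ (P.- A₁)      ≈⟨ P.+-assoc P.1# A₁ (P.- A₁) ⟩
      P.1# P.+ (A₁ P.+ (P.- A₁))      ≈⟨ P.+-congˡ {P.1#} (P.-‿inverseʳ A₁) ⟩
      P.1# P.+ (λ _ → 0#)           ≈⟨ P.+-identityʳ P.1# ⟩
      P.1#                          ∎
      where
      A₁ : P.Series
      A₁ = ∑≥1-t²ⁿ a

-- The recurrence for the sums over fillings

module Recurrence {c ℓ} (R : CommutativeRing c ℓ) where
  open CommutativeRing R
  open ListSum R
  open Weights R
  open SemiringSum semiring
  open SemiringExp semiring
  open SemiringMult semiring
    using (×1-homo-*; ×-congˡ) renaming (_×_ to _×ᴺ_)
  open SetoidReasoning setoid
  open SemiringSolver commutativeSemiring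
    using (solve; _:=_; _:+_; _:*_; con)

  module _ {k : ℕ} {p q : ℕ} {f : Array k p → Carrier} {g : Array k q → Carrier}
    (f-inv : OrderInvariant f) (g-inv : OrderInvariant g)
    (h : Array k (p ℕ.+ q) → Carrier) (h≈ : ∀ F G → h (F Vec.++ G) ≈ f F * g G) where

    -- The binomial coefficient counts the possible sets of entries of the first p
    -- columns.
    ∑-fillings-+ : ∑ (fillings k (p ℕ.+ q)) h ≈
      (((k ℕ.* (p ℕ.+ q)) C (p ℕ.* k)) ×ᴺ 1#) * (∑ (fillings k p) f * ∑ (fillings k q) g)
    ∑-fillings-+ = begin
      ∑ (fillings k (p ℕ.+ q)) h
        ≈⟨ ∑-↭ h (fillings↭arrangements k (p ℕ.+ q)) ⟩
      ∑ (arrangements k (p ℕ.+ q) X) h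
        ≈⟨ ∑-arrangements-+ k p q X h ⟩
      ∑ (splits (p ℕ.* k) X) (λ s → ∑ (arrangements k p (toList (proj₁ s))) λ F →
        ∑ (arrangements k q (proj₂ s)) λ G → h (F Vec.++ G))
        ≈⟨ ∑-cong (splits (p ℕ.* k) X) (λ s → product (toList (proj₁ s)) (proj₂ s)) ⟩
      ∑ (splits (p ℕ.* k) X) (λ s →
        ∑ (arrangements k p (toList (proj₁ s))) f * ∑ (arrangements k q (proj₂ s)) g)
        ≈⟨ ∑-cong-All (All.zipWith (λ {s} → standardise s)
             (splits-allPairs (p ℕ.* k) ([1⋯]-increasing N) , splits-length (p ℕ.* k) X)) ⟩
      ∑ (splits (p ℕ.* k) X) (λ _ → ∑ (fillings k p) f * ∑ (fillings k q) g)
        ≈⟨ ∑-const (splits (p ℕ.* k) X) _ ⟩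
      (length (splits (p ℕ.* k) X) ×ᴺ 1#) * (∑ (fillings k p) f * ∑ (fillings k q) g)
        ≈⟨ *-congʳ (×-congˡ (≡.trans (length-splits (p ℕ.* k) X)
             (cong (_C (p ℕ.* k)) (List.length-applyUpTo suc N)))) ⟩
      ((N C (p ℕ.* k)) ×ᴺ 1#) * (∑ (fillings k p) f * ∑ (fillings k q) g) ∎
      where
      N : ℕ
      N = k ℕ.* (p ℕ.+ q)

      X : List ℕ
      X = [1⋯ N ]

      product : ∀ S T → ∑ (arrangements k p S) (λ F → ∑ (arrangements k q T) λ G → h (F Vec.++ G)) ≈
        ∑ (arrangements k p S) f * ∑ (arrangements k q T) g
      product S T = trans
        (∑-cong (arrangements k p S) (λ F → trans (∑-cong (arrangements k q T) (h≈ F))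
          (sym (*-distribˡ-∑ (f F) (arrangements k q T) g))))
        (sym (*-distribʳ-∑ _ (arrangements k p S) f))

      toFillings : ∀ {n} {e : Array k n → Carrier} → OrderInvariant e → ∀ {S} → AllPairs ℕ._<_ S →
        length S ≡ n ℕ.* k → ∑ (arrangements k n S) e ≈ ∑ (fillings k n) e
      toFillings {n} {e} e-inv S↗ len = trans
        (∑-arrangements-invariant e-inv S↗ ([1⋯]-increasing (k ℕ.* n))
          (≡.trans len (≡.trans (ℕ.*-comm n k) (≡.sym (List.length-applyUpTo suc (k ℕ.* n))))))
        (sym (∑-↭ e (fillings↭arrangements k n)))

      -- Whatever the entries of the two parts are, they can be relabelled 1, 2, ...
      standardise : ∀ s → (AllPairs ℕ._<_ (toList (proj₁ s)) × AllPairs ℕ._<_ (proj₂ s)) ×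
        p ℕ.* k ℕ.+ length (proj₂ s) ≡ length X →
        ∑ (arrangements k p (toList (proj₁ s))) f * ∑ (arrangements k q (proj₂ s)) g ≈
          ∑ (fillings k p) f * ∑ (fillings k q) g
      standardise (S , T) ((S↗ , T↗) , len) = *-cong
        (toFillings f-inv S↗ (Vec.length-toList S))
        (toFillings g-inv T↗ (ℕ.+-cancelˡ-≡ (p ℕ.* k) _ _ (≡.trans len
          (≡.trans (List.length-applyUpTo suc N)
            (≡.trans (ℕ.*-comm k (p ℕ.+ q)) (ℕ.*-distribʳ-+ k p q))))))

  -- The value φ m plays the role of 1 / m!.
  module _ (φ : ℕ → Carrier) (φ-inverse : ∀ m → φ m * ((m !) ×ᴺ 1#) ≈ 1#) where

    φ-binomial : ∀ a b → φ (a ℕ.+ b) * (((a ℕ.+ b) C a) ×ᴺ 1#) ≈ φ a * φ b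
    φ-binomial a b = begin
      φ (a ℕ.+ b) * B
        ≈⟨ solve 2 (λ u v → u :* v := u :* v :* (con 1 :* con 1)) refl _ _ ⟩
      φ (a ℕ.+ b) * B * (1# * 1#)
        ≈⟨ *-congˡ (*-cong (φ-inverse a) (φ-inverse b)) ⟨
      φ (a ℕ.+ b) * B * ((φ a * ((a !) ×ᴺ 1#)) * (φ b * ((b !) ×ᴺ 1#)))
        ≈⟨ solve 6 (λ u v x y z w → u :* v :* ((x :* y) :* (z :* w)) := (u :* (v :* (y :* w))) :* (x :* z))
             refl _ _ _ _ _ _ ⟩
      (φ (a ℕ.+ b) * (B * (((a !) ×ᴺ 1#) * ((b !) ×ᴺ 1#)))) * (φ a * φ b)
        ≈⟨ *-congʳ (*-congˡ factorials) ⟩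
      (φ (a ℕ.+ b) * (((a ℕ.+ b) !) ×ᴺ 1#)) * (φ a * φ b)
        ≈⟨ *-congʳ (φ-inverse (a ℕ.+ b)) ⟩
      1# * (φ a * φ b)
        ≈⟨ *-identityˡ _ ⟩
      φ a * φ b ∎
      where
      B : Carrier
      B = ((a ℕ.+ b) C a) ×ᴺ 1#

      factorials : B * (((a !) ×ᴺ 1#) * ((b !) ×ᴺ 1#)) ≈ ((a ℕ.+ b) !) ×ᴺ 1#
      factorials = begin
        B * (((a !) ×ᴺ 1#) * ((b !) ×ᴺ 1#))            ≈⟨ *-congˡ (×1-homo-* (a !) (b !)) ⟨
        B * ((a ! ℕ.* b !) ×ᴺ 1#)                      ≈⟨ ×1-homo-* ((a ℕ.+ b) C a) (a ! ℕ.* b !) ⟨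
        (((a ℕ.+ b) C a) ℕ.* (a ! ℕ.* b !)) ×ᴺ 1#
          ≈⟨ ×-congˡ (≡.trans (cong (λ m → ((a ℕ.+ b) C a) ℕ.* (a ! ℕ.* m !)) (≡.sym (ℕ.m+n∸m≡n a b)))
               (nCk*k![n∸k]!≡n! (ℕ.m≤m+n a b))) ⟩
        ((a ℕ.+ b) !) ×ᴺ 1#                            ∎

    -- The sum of h over the fillings with n columns, divided by the factorial of
    -- the number of entries.
    egfCoeff : (k n : ℕ) → (List (Vec ℕ k) → Carrier) → Carrier
    egfCoeff k n h = φ (k ℕ.* n) * ∑ (fillings k n) (h ∘ toList)

    -- The coefficients of an exponential generating function multiply: a cut of the
    -- columns after the first p decouples the two parts.
    egfCoeff-* : ∀ {k} {f g : List (Vec ℕ k) → Carrier} →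
      (∀ {n} → OrderInvariant {k} {n} (f ∘ toList)) → (∀ {n} → OrderInvariant {k} {n} (g ∘ toList)) →
      ∀ {N} p q → N ≡ p ℕ.+ q →
      egfCoeff k N (λ cs → f (take p cs) * g (drop p cs)) ≈ egfCoeff k p f * egfCoeff k q g
    egfCoeff-* {k} {f} {g} f-inv g-inv p q ≡.refl = begin
      φ (k ℕ.* (p ℕ.+ q)) * ∑ (fillings k (p ℕ.+ q)) h
        ≈⟨ *-congˡ (∑-fillings-+ {p = p} {q} {f ∘ toList} {g ∘ toList} f-inv g-inv h (λ F G → reflexive (cong₂ (λ cs ds → f cs * g ds)
             (take-++ F G) (drop-++ F G)))) ⟩
      φ (k ℕ.* (p ℕ.+ q)) * ((((k ℕ.* (p ℕ.+ q)) C (p ℕ.* k)) ×ᴺ 1#) * (s * t))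
        ≡⟨ cong₂ (λ a N → φ N * ((N C a) ×ᴺ 1# * (s * t))) (ℕ.*-comm p k) (ℕ.*-distribˡ-+ k p q) ⟩
      φ (k ℕ.* p ℕ.+ k ℕ.* q) * ((((k ℕ.* p ℕ.+ k ℕ.* q) C (k ℕ.* p)) ×ᴺ 1#) * (s * t))
        ≈⟨ *-assoc _ _ _ ⟨
      φ (k ℕ.* p ℕ.+ k ℕ.* q) * (((k ℕ.* p ℕ.+ k ℕ.* q) C (k ℕ.* p)) ×ᴺ 1#) * (s * t)
        ≈⟨ *-congʳ (φ-binomial (k ℕ.* p) (k ℕ.* q)) ⟩
      φ (k ℕ.* p) * φ (k ℕ.* q) * (s * t)
        ≈⟨ solve 4 (λ u v x y → u :* v :* (x :* y) := (u :* x) :* (v :* y)) refl _ _ _ _ ⟩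
      (φ (k ℕ.* p) * s) * (φ (k ℕ.* q) * t) ∎
      where
      h : Array k (p ℕ.+ q) → Carrier
      h F = f (take p (toList F)) * g (drop p (toList F))

      s t : Carrier
      s = ∑ (fillings k p) (f ∘ toList)
      t = ∑ (fillings k q) (g ∘ toList)

      take-++ : ∀ {m n} (F : Array k m) (G : Array k n) → take m (toList (F Vec.++ G)) ≡ toList F
      take-++ []      G = ≡.refl
      take-++ (c ∷ F) G = cong (c ∷_) (take-++ F G)

      drop-++ : ∀ {m n} (F : Array k m) (G : Array k n) → drop m (toList (F Vec.++ G)) ≡ toList G
      drop-++ []      G = ≡.refl
      drop-++ (c ∷ F) G = drop-++ F G

    module _ {ℓ′} {k : ℕ} {Υ : Pred (Array k 2) ℓ′} (Υ? : Decidable Υ) (y : Carrier) where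

      private
        E P : List (Vec ℕ k) → Carrier
        E = chainWeight (match Υ?)
        P = pairedWeight (match Υ?) y

      egfCoeff-pairedWeight : ∀ n → egfCoeff k (2 ℕ.* suc n) P ≈
        ∑[ i ≤ n ] ((egfCoeff k (2 ℕ.* suc (toℕ i)) E * y ^ toℕ i) * egfCoeff k (2 ℕ.* (n ∸ toℕ i)) P)
      egfCoeff-pairedWeight n = begin
        φ N * ∑ Fs (P ∘ toList)
          ≈⟨ *-congˡ (∑-cong Fs (λ F → pairedWeight-cut (match Υ?) y n (toList F) (Vec.length-toList F))) ⟩
        φ N * ∑ Fs (λ F → ∑[ i ≤ n ] (y ^ toℕ i * cut i F))
          ≈⟨ *-congˡ (∑-exchange Fs (suc n) (λ F i → y ^ toℕ i * cut i F)) ⟩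
        φ N * ∑[ i ≤ n ] ∑ Fs (λ F → y ^ toℕ i * cut i F)
          ≈⟨ *-distribˡ-sum {suc n} (φ N) (λ i → ∑ Fs (λ F → y ^ toℕ i * cut i F)) ⟩
        ∑[ i ≤ n ] (φ N * ∑ Fs (λ F → y ^ toℕ i * cut i F))
          ≈⟨ sum-cong-≋ {suc n} term ⟩
        ∑[ i ≤ n ] ((egfCoeff k (2 ℕ.* suc (toℕ i)) E * y ^ toℕ i) * egfCoeff k (2 ℕ.* (n ∸ toℕ i)) P) ∎
        where
        N : ℕ
        N = k ℕ.* (2 ℕ.* suc n)

        Fs : List (Array k (2 ℕ.* suc n))
        Fs = fillings k (2 ℕ.* suc n)

        cut : Fin (suc n) → Array k (2 ℕ.* suc n) → Carrier
        cut i F = E (take (2 ℕ.* suc (toℕ i)) (toList F)) * P (drop (2 ℕ.* suc (toℕ i)) (toList F))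

        term : ∀ i → φ N * ∑ Fs (λ F → y ^ toℕ i * cut i F) ≈
          (egfCoeff k (2 ℕ.* suc (toℕ i)) E * y ^ toℕ i) * egfCoeff k (2 ℕ.* (n ∸ toℕ i)) P
        term i = begin
          φ N * ∑ Fs (λ F → y ^ toℕ i * cut i F)
            ≈⟨ *-congˡ (*-distribˡ-∑ (y ^ toℕ i) Fs (cut i)) ⟨
          φ N * (y ^ toℕ i * ∑ Fs (cut i))
            ≈⟨ solve 3 (λ u v w → u :* (v :* w) := v :* (u :* w)) refl _ _ _ ⟩
          y ^ toℕ i * (φ N * ∑ Fs (cut i))
            ≈⟨ *-congˡ (egfCoeff-* {f = E} {P} (chainWeight-invariant Υ?) (pairedWeight-invariant Υ? y)
                 (2 ℕ.* suc (toℕ i)) (2 ℕ.* (n ∸ toℕ i))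
                 (≡.trans (cong (λ m → 2 ℕ.* suc m) (≡.sym (ℕ.m+[n∸m]≡n (ℕ.≤-pred (Fin.toℕ<n i)))))
                   (ℕ.*-distribˡ-+ 2 (suc (toℕ i)) (n ∸ toℕ i)))) ⟩
          y ^ toℕ i * (egfCoeff k (2 ℕ.* suc (toℕ i)) E * egfCoeff k (2 ℕ.* (n ∸ toℕ i)) P)
            ≈⟨ solve 3 (λ u v w → u :* (v :* w) := (v :* u) :* w) refl _ _ _ ⟩
          _ ∎

      full≈∑chainWeight : ∀ n → full Υ? n ×ᴺ 1# ≈ ∑ (fillings k n) (E ∘ toList)
      full≈∑chainWeight n = begin
        full Υ? n ×ᴺ 1#             ≈⟨ *-identityʳ _ ⟨
        (full Υ? n ×ᴺ 1#) * 1#      ≈⟨ ∑-const (filter (matchesEverywhere? Υ?) (fillings k n)) 1# ⟨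
        ∑ (filter (matchesEverywhere? Υ?) (fillings k n)) (λ _ → 1#)
          ≈⟨ ∑-filter (matchesEverywhere? Υ?) (fillings k n) _ ⟩
        ∑ (fillings k n) (λ F → indicator (does (matchesEverywhere? Υ? F)) * 1#)
          ≈⟨ ∑-cong (fillings k n) (λ F → trans (*-identityʳ _) (indicator-matchesEverywhere Υ? F)) ⟩
        ∑ (fillings k n) (E ∘ toList) ∎

      ∑-fillings⁽²⁾ : ∀ {x} → 1# + y ≈ x → ∀ n →
        ∑ (fillings⁽²⁾ Υ? n) (λ F → x ^ mch⁽²⁾ Υ? F) ≈ ∑ (fillings k (2 ℕ.* n)) (P ∘ toList)
      ∑-fillings⁽²⁾ 1+y≈x n = trans
        (∑-filter (matchesAtOdd? Υ?) (fillings k (2 ℕ.* n)) _)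
        (∑-cong (fillings k (2 ℕ.* n)) (λ F →
          indicator-matchesAtOdd-power Υ? 1+y≈x F (2 ℕ.* n) ℕ.≤-refl))

    -- The value κ j m plays the role of j / m!.
    module _ {ℓ′} {k : ℕ} {Υ : Pred (Array k 2) ℓ′} (Υ? : Decidable Υ)
      (κ : ℕ → ℕ → Carrier) (κ-* : ∀ j m → κ j m ≈ φ m * (j ×ᴺ 1#)) (x : Carrier) where

      open EvenSeries R
      open PowerSeries R using (∑≥1-t²ⁿ; 1/_) renaming (_≈_ to _≈′_)
      private module P = CommutativeRing (PowerSeries.commutativeRing R)

      -- The theorem over any commutative ring with inverse factorials, at any x.
      generatingFunction :
        P.1# P.+ ∑≥1-t²ⁿ (λ n → κ 1 (2 ℕ.* k ℕ.* n) *
          ∑ (fillings⁽²⁾ Υ? n) (λ F → x ^ mch⁽²⁾ Υ? F)) ≈′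
        1/ (P.1# P.- ∑≥1-t²ⁿ (λ n → κ (full Υ? (2 ℕ.* n)) (2 ℕ.* k ℕ.* n) * (x - 1#) ^ (n ∸ 1)))
      generatingFunction = 1+∑≥1-t²ⁿ-reciprocal _ _ (trans (a≈ 0) egfCoeff-0) λ n → begin
        a (suc n)   ≈⟨ a≈ (suc n) ⟩
        egfCoeff k (2 ℕ.* suc n) P ≈⟨ egfCoeff-pairedWeight Υ? y n ⟩
        ∑[ i ≤ n ] ((egfCoeff k (2 ℕ.* suc (toℕ i)) E * y ^ toℕ i) * egfCoeff k (2 ℕ.* (n ∸ toℕ i)) P)
          ≈⟨ sum-cong-≋ {suc n} (λ i → *-cong (b≈ (toℕ i)) (a≈ (n ∸ toℕ i))) ⟨
        ∑[ i ≤ n ] (b (suc (toℕ i)) * a (n ∸ toℕ i)) ∎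
        where
        y : Carrier
        y = x - 1#

        1+y≈x : 1# + y ≈ x
        1+y≈x = trans (+-comm 1# y) (trans (+-assoc x (- 1#) 1#)
          (trans (+-congˡ (-‿inverseˡ 1#)) (+-identityʳ x)))

        E P : List (Vec ℕ k) → Carrier
        E = chainWeight (match Υ?)
        P = pairedWeight (match Υ?) y

        a b : ℕ → Carrier
        a n = κ 1 (2 ℕ.* k ℕ.* n) * ∑ (fillings⁽²⁾ Υ? n) (λ F → x ^ mch⁽²⁾ Υ? F)
        b n = κ (full Υ? (2 ℕ.* n)) (2 ℕ.* k ℕ.* n) * y ^ (n ∸ 1)

        size : ∀ n → 2 ℕ.* k ℕ.* n ≡ k ℕ.* (2 ℕ.* n)
        size n = ≡.trans (cong (ℕ._* n) (ℕ.*-comm 2 k)) (ℕ.*-assoc k 2 n)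

        κ-size : ∀ j n → κ j (2 ℕ.* k ℕ.* n) ≈ φ (k ℕ.* (2 ℕ.* n)) * (j ×ᴺ 1#)
        κ-size j n = trans (κ-* j _) (reflexive (cong (λ m → φ m * (j ×ᴺ 1#)) (size n)))

        a≈ : ∀ n → a n ≈ egfCoeff k (2 ℕ.* n) P
        a≈ n = *-cong (trans (κ-size 1 n) (trans (*-congˡ (+-identityʳ 1#)) (*-identityʳ _)))
          (∑-fillings⁽²⁾ Υ? y 1+y≈x n)

        b≈ : ∀ i → b (suc i) ≈ egfCoeff k (2 ℕ.* suc i) E * y ^ i
        b≈ i = *-congʳ (trans (κ-size (full Υ? (2 ℕ.* suc i)) (suc i))
          (*-congˡ (full≈∑chainWeight Υ? y (2 ℕ.* suc i))))

        egfCoeff-0 : egfCoeff k 0 P ≈ 1#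
        egfCoeff-0 = begin
          φ (k ℕ.* 0) * ∑ (fillings k 0) (P ∘ toList)
            ≈⟨ *-congˡ (∑-↭ (P ∘ toList) (fillings↭arrangements k 0)) ⟩
          φ (k ℕ.* 0) * (1# + 0#)
            ≡⟨ cong (λ m → φ m * (1# + 0#)) (ℕ.*-zeroʳ k) ⟩
          φ 0 * (1 ×ᴺ 1#)
            ≈⟨ φ-inverse 0 ⟩
          1# ∎

-- Inverse factorials in ℚ and ℚ[x]

open import Data.Integer.Base using (+_)

/-+ : ∀ i j d .{{_ : ℕ.NonZero d}} → (+ i ℚ./ d) ℚ.+ (+ j ℚ./ d) ≡ + (i ℕ.+ j) ℚ./ d
/-+ i j d@(suc d-1) = ℚ.toℚᵘ-injective (begin
  toℚᵘ ((+ i ℚ./ d) ℚ.+ (+ j ℚ./ d))         ≈⟨ ℚ.toℚᵘ-homo-+ (+ i ℚ./ d) (+ j ℚ./ d) ⟩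
  toℚᵘ (+ i ℚ./ d) ℚᵘ.+ toℚᵘ (+ j ℚ./ d)
    ≈⟨ ℚᵘ.+-cong (ℚ.toℚᵘ-fromℚᵘ (mkℚᵘ (+ i) d-1)) (ℚ.toℚᵘ-fromℚᵘ (mkℚᵘ (+ j) d-1)) ⟩
  mkℚᵘ (+ i) d-1 ℚᵘ.+ mkℚᵘ (+ j) d-1         ≈⟨ *≡* common ⟩
  mkℚᵘ (+ (i ℕ.+ j)) d-1                     ≈⟨ ℚ.toℚᵘ-fromℚᵘ (mkℚᵘ (+ (i ℕ.+ j)) d-1) ⟨
  toℚᵘ (+ (i ℕ.+ j) ℚ./ d)                   ∎)
  where
  open SetoidReasoning ℚᵘ.≃-setoid
  common : ((+ i) ℤ.* (+ d) ℤ.+ (+ j) ℤ.* (+ d)) ℤ.* (+ d) ≡ + (i ℕ.+ j) ℤ.* + (d ℕ.* d)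
  common = ≡.trans (cong (ℤ._* (+ d)) (≡.sym (ℤ.*-distribʳ-+ (+ d) (+ i) (+ j))))
    (≡.trans (ℤ.*-assoc (+ (i ℕ.+ j)) (+ d) (+ d)) (cong (+ (i ℕ.+ j) ℤ.*_) (≡.sym (ℤ.pos-* d d))))

n/n≡1 : ∀ n .{{_ : ℕ.NonZero n}} → + n ℚ./ n ≡ 1ℚ
n/n≡1 (suc n) = ℚ.fromℚᵘ-cong {mkℚᵘ (+ suc n) n} {mkℚᵘ (+ 1) 0} (*≡* (ℤ.*-comm (+ suc n) (+ 1)))

module _ where
  open ℚ[x]
  open SemiringMult semiring using () renaming (_×_ to _×ᴺ_)

  constant-0 : constant 0ℚ ≈ 0#
  constant-0 zero    = ≡.refl
  constant-0 (suc n) = ≡.refl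

  constant-/! : ∀ j m → constant (j /[ m ]!) ≈ constant (1 /[ m ]!) * (j ×ᴺ 1#)
  constant-/! zero    m = begin
    constant (0 /[ m ]!)             ≡⟨ cong constant (ℚ.0/n≡0 (m !) {{m ℕ.!≢0}}) ⟩
    constant 0ℚ                      ≈⟨ constant-0 ⟩
    0#                               ≈⟨ zeroʳ (constant (1 /[ m ]!)) ⟨
    constant (1 /[ m ]!) * 0#        ∎
    where open SetoidReasoning setoid
  constant-/! (suc j) m = begin
    constant (suc j /[ m ]!)   ≡⟨ cong constant (/-+ 1 j (m !) {{m ℕ.!≢0}}) ⟨
    c + constant (j /[ m ]!)   ≈⟨ +-cong {c} {c * 1#} {constant (j /[ m ]!)} {c * (j ×ᴺ 1#)}
                                    (sym {c * 1#} {c} (*-identityʳ c)) (constant-/! j m) ⟩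
    c * 1# + c * (j ×ᴺ 1#)     ≈⟨ distribˡ c 1# (j ×ᴺ 1#) ⟨
    c * (1# + (j ×ᴺ 1#))       ∎
    where
    open SetoidReasoning setoid
    c : Carrier
    c = constant (1 /[ m ]!)

  constant-1/!-inverse : ∀ m → constant (1 /[ m ]!) * ((m !) ×ᴺ 1#) ≈ 1#
  constant-1/!-inverse m = begin
    constant (1 /[ m ]!) * ((m !) ×ᴺ 1#)   ≈⟨ constant-/! (m !) m ⟨
    constant ((m !) /[ m ]!)               ≡⟨ cong constant (n/n≡1 (m !) {{m ℕ.!≢0}}) ⟩
    1#                                     ∎
    where open SetoidReasoning setoid

open import Data.Nat.Base using (_*_)

theorem7 : ∀ {ℓ : Level} (k : ℕ) → 1 ≤ k →
    (Υ : Pred (Array k 2) ℓ) → Υ ⊆ Filling → (Υ? : Decidable Υ) →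
    ℚ[x]⟦t⟧.1#
    ℚ[x]⟦t⟧.+ ℚ[x]⟦t⟧.∑≥1-t²ⁿ (λ n →
    ℚ[x].constant (1 /[ 2 * k * n ]!)
    ℚ[x].* ℚ[x].∑ (fillings⁽²⁾ Υ? n) (λ F → ℚ[x].X ℚ[x].^ mch⁽²⁾ Υ? F))
    ℚ[x]⟦t⟧.≈
    ℚ[x]⟦t⟧.1/ (ℚ[x]⟦t⟧.1#
    ℚ[x]⟦t⟧.- ℚ[x]⟦t⟧.∑≥1-t²ⁿ (λ n →
    ℚ[x].constant (full Υ? (2 * n) /[ 2 * k * n ]!)
    ℚ[x].* (ℚ[x].X ℚ[x].- ℚ[x].1#) ℚ[x].^ (n ∸ 1)))
theorem7 k _ Υ _ Υ? = Recurrence.generatingFunction ℚ[x]-ring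
  (λ m → ℚ[x].constant (1 /[ m ]!)) constant-1/!-inverse
  Υ? (λ j m → ℚ[x].constant (j /[ m ]!)) constant-/! ℚ[x].X
  where
  ℚ[x]-ring : CommutativeRing _ _
  ℚ[x]-ring = Polynomial.commutativeRing ℚ.+-*-commutativeRing
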